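{- Let $G$ be a graph and let $S(G)$ be its full subdivision. Then: (i) if $\chi(G)\le 3$, then $\chi_{\mathrm{pcf}}(S(G))\le 4$; (ii) if $\chi(G)\le 4$, then $\chi_{\mathrm{o}}(S(G))\le 4$. Moreover, there exist bipartite graphs $G$ with $\chi_{\mathrm{o}}(S(G))=4$.
   Context: Graphs are finite and simple. The full subdivision $S(G)$ is the graph obtained from $G$ by subdividing each edge exactly once. $\chi(G)$ is the chromatic number. A proper odd (resp. proper conflict-free) coloring is a proper vertex coloring in which for every non-isolated vertex some color appears an odd number of times (resp. exactly once) in its open neighborhood; $\chi_{\mathrm{o}}$ (resp. $\chi_{\mathrm{pcf}}$) is the least number of colors in such a coloring. -}

module Defs where

open import Data.Bool.Base using (Bool)
open import Data.Empty using (⊥)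
open import Data.Fin.Base using (Fin; splitAt)
open import Data.Fin.Properties using (_≟_; _<?_)
open import Data.List.Base using (List; length; filter; allFin; cartesianProduct; lookup)
open import Data.Nat.Base using (ℕ; _+_; _≤_; parity)
open import Data.Parity.Base using (1ℙ)
open import Data.Product.Base using (_×_; _,_; ∃; ∃-syntax; proj₁; proj₂)
open import Data.Sum.Base using (_⊎_; inj₁; inj₂)
open import Level using (0ℓ)
open import Relation.Binary.Core using (Rel)
open import Relation.Binary.Definitions using (Decidable; Irreflexive; Symmetric)
open import Relation.Binary.PropositionalEquality using (_≡_; _≢_; refl)
open import Relation.Nullary.Decidable using (no; _×-dec_; _⊎-dec_)

record Graph (n : ℕ) : Set₁ where
  field
    Adj    : Rel (Fin n) 0ℓ
    adj?   : Decidable Adj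
    sym    : Symmetric Adj
    irrefl : Irreflexive _≡_ Adj

open Graph public using (Adj; adj?)

neighbours : ∀ {n} → Graph n → Fin n → List (Fin n)
neighbours {n} G v = filter (adj? G v) (allFin n)

NonIsolated : ∀ {n} → Graph n → Fin n → Set
NonIsolated G v = ∃[ w ] Adj G v w

-- Each edge is listed once, as the pair (u , v) of its ends with u < v.
edges : ∀ {n} → Graph n → List (Fin n × Fin n)
edges {n} G =
  filter (λ (u , v) → (u <? v) ×-dec adj? G u v)
         (cartesianProduct (allFin n) (allFin n))

-- The full subdivision. Its vertex set Fin (n + |E|) is read through splitAt
-- as Fin n ⊎ Fin |E|: the vertices of G, followed by one new vertex for each
-- position in the list of edges.
module Subdivision {n : ℕ} (G : Graph n) where

  m : ℕ
  m = length (edges G)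

  IsEnd : Fin n → Fin m → Set
  IsEnd v e = v ≡ proj₁ (lookup (edges G) e) ⊎ v ≡ proj₂ (lookup (edges G) e)

  isEnd? : Decidable IsEnd
  isEnd? v e =
    (v ≟ proj₁ (lookup (edges G) e)) ⊎-dec (v ≟ proj₂ (lookup (edges G) e))

  SAdj : Rel (Fin n ⊎ Fin m) 0ℓ
  SAdj (inj₁ v) (inj₂ e) = IsEnd v e
  SAdj (inj₂ e) (inj₁ v) = IsEnd v e
  SAdj (inj₁ _) (inj₁ _) = ⊥
  SAdj (inj₂ _) (inj₂ _) = ⊥

  sAdj? : Decidable SAdj
  sAdj? (inj₁ v) (inj₂ e) = isEnd? v e
  sAdj? (inj₂ e) (inj₁ v) = isEnd? v e
  sAdj? (inj₁ _) (inj₁ _) = no λ ()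
  sAdj? (inj₂ _) (inj₂ _) = no λ ()

  sAdj-sym : Symmetric SAdj
  sAdj-sym {inj₁ _} {inj₂ _} p = p
  sAdj-sym {inj₂ _} {inj₁ _} p = p

  sAdj-irrefl : ∀ x → SAdj x x → ⊥
  sAdj-irrefl (inj₁ _) ()
  sAdj-irrefl (inj₂ _) ()

S : ∀ {n} (G : Graph n) → Graph (n + length (edges G))
S {n} G = record
  { Adj    = λ x y → SAdj (splitAt n x) (splitAt n y)
  ; adj?   = λ x y → sAdj? (splitAt n x) (splitAt n y)
  ; sym    = λ {x} {y} → sAdj-sym {splitAt n x} {splitAt n y}
  ; irrefl = λ { {x} refl → sAdj-irrefl (splitAt n x) }
  }
  where open Subdivision G

Coloring : ℕ → ℕ → Set
Coloring n k = Fin n → Fin k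

occurrences : ∀ {n k} → Graph n → Coloring n k → Fin n → Fin k → ℕ
occurrences G c v i = length (filter (λ w → c w ≟ i) (neighbours G v))

Proper : ∀ {n k} → Graph n → Coloring n k → Set
Proper G c = ∀ u v → Adj G u v → c u ≢ c v

ProperOdd : ∀ {n k} → Graph n → Coloring n k → Set
ProperOdd G c = Proper G c ×
  (∀ v → NonIsolated G v → ∃[ i ] parity (occurrences G c v i) ≡ 1ℙ)

ProperConflictFree : ∀ {n k} → Graph n → Coloring n k → Set
ProperConflictFree G c = Proper G c ×
  (∀ v → NonIsolated G v → ∃[ i ] occurrences G c v i ≡ 1)

IsLeast : (ℕ → Set) → ℕ → Set
IsLeast P k = P k × (∀ j → P j → k ≤ j)

-- The chromatic parameters are given as relations: χ G k says that the
-- parameter of G has the value k (which is unique, by minimality).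
χ χₒ χpcf : ∀ {n} → Graph n → ℕ → Set
χ    {n} G = IsLeast λ k → ∃ λ (c : Coloring n k) → Proper G c
χₒ   {n} G = IsLeast λ k → ∃ λ (c : Coloring n k) → ProperOdd G c
χpcf {n} G = IsLeast λ k → ∃ λ (c : Coloring n k) → ProperConflictFree G c

infix 4 _≤ᵛ_

-- For a parameter given by its relation P, "its value is at most b".
_≤ᵛ_ : (ℕ → Set) → ℕ → Set
P ≤ᵛ b = ∃[ k ] (P k × k ≤ b)

Bipartite : ∀ {n} → Graph n → Set
Bipartite {n} G = ∃ λ (side : Fin n → Bool) → ∀ u v → Adj G u v → side u ≢ side v

{-# OPTIONS --safe #-}

-- The vertex of S G subdividing uv sees exactly the colours of u and v. So one
-- has to colour G properly, and the edges of G with colours different from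
-- those of their ends, such that every non-isolated vertex v sees some colour
-- an odd number of times (exactly once) on the edges at v.
--
-- Odd colourings, four colours. Call v bad if it sees every colour an even
-- number of times. An edge has two admissible colours; switching it at a bad
-- vertex makes that vertex good and changes nothing but the other end, so
-- badness moves along edges like a token. If all neighbours of the token's
-- vertex have one colour, recolouring that vertex destroys the token.
-- Otherwise the token can leave towards a vertex coloured differently from the
-- one it came from. When it first returns to a visited vertex, it either dies
-- there or dies after one more step along the edge of the first departure.
--
-- Conflict-free colourings, three colours in ℤ/3 for the vertices of G. Orient
-- uv from u to v if c v = c u + 1. If v is not a source, give one edge into v
-- the colour in ℤ/3 missing at its ends and the other edges into v the colour
-- 3; the former occurs once at v, since the edges leaving v use another
-- missing colour or 3. Subtracting 1 from the colour of a source makes it a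
-- sink. If this is never done on a maximal set R of vertices at pairwise
-- distance > 4, it stops, and then all sources are in R. For a source r, the
-- colour 3 is made unique at r and at one out-neighbour w of r by exchanging
-- the roles of the two colours on the edges into w.
--
-- S C₄ is an 8-cycle, where an odd colouring gives three different colours to
-- any three consecutive vertices; with three colours it would have period 3.
module Submission where

open import Defs
open import Data.Bool.Base using (Bool; true; false; if_then_else_)
import Data.Bool.Properties as Bool
open import Data.Empty using (⊥; ⊥-elim)
open import Data.Fin.Base as Fin using (Fin; zero; suc; splitAt; _↑ˡ_; _↑ʳ_; finToFun; funToFin; inject≤; inject₁)
open import Data.Fin.Patterns
open import Data.Fin.Properties
  using ( _≟_; _<?_; any?; all?; splitAt-↑ˡ; splitAt-↑ʳ; splitAt⁻¹-↑ˡ; splitAt⁻¹-↑ʳ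
        ; finToFun-funToFin; inject≤-injective; inject₁-injective; <⇒≢; <-asym; <-cmp)
open import Data.List.Base
  using (List; []; _∷_; _++_; length; filter; map; tabulate; allFin; lookup; cartesianProduct)
open import Data.List.Membership.DecPropositional using () renaming (_∈?_ to member?)
open import Data.List.Membership.Propositional using (_∈_; _∉_; lose; find)
open import Data.List.Membership.Propositional.Properties
  using (∈-filter⁺; ∈-filter⁻; ∈-allFin; ∈-lookup; ∈-cartesianProduct⁺)
open import Data.List.Properties
  using (filter-++; filter-none; filter-all; filter-notAll; map-tabulate)
open import Data.List.Relation.Unary.All as All using (All; []; _∷_)
open import Data.List.Relation.Unary.All.Properties using (tabulate⁺)
open import Data.List.Relation.Unary.AllPairs using ([]; _∷_)
open import Data.List.Relation.Unary.Any as Any using (here; there)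
open import Data.List.Relation.Unary.Any.Properties using (lookup-index)
open import Data.List.Relation.Unary.Unique.Propositional using (Unique)
import Data.List.Relation.Unary.Unique.Propositional.Properties as Unique
open import Data.Nat.Base as ℕ using (ℕ; zero; suc; _+_; _*_; _≤_; parity; z≤n; s≤s; s≤s⁻¹)
open import Data.Nat.ListAction using (sum)
import Data.Nat.Properties as ℕ
open import Data.Parity.Base using (0ℙ; 1ℙ)
import Data.Parity.Properties as ℙ
open import Data.Product.Base using (_×_; _,_; ∃; ∃-syntax; ∃₂; proj₁; proj₂)
open import Data.Sum.Base using (_⊎_; inj₁; inj₂; [_,_]′)
open import Data.Unit.Base using (tt)
open import Data.Vec.Functional using (updateAt)
open import Data.Vec.Functional.Properties using (updateAt-updates; updateAt-minimal)
open import Function.Base using (_∘_; const; id)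
open import Level using (0ℓ)
open import Relation.Binary.Core using (Rel)
import Relation.Binary.Definitions as B
open import Relation.Binary.Definitions using (tri<; tri≈; tri>)
open import Relation.Binary.PropositionalEquality
open import Relation.Nullary using (¬_; Dec; yes; no; does; contradiction)
open import Relation.Nullary.Decidable
  using (map′; _×-dec_; _⊎-dec_; _→-dec_; ¬?; toWitness; decidable-stable)
open import Relation.Unary using (Pred; Decidable)

-- Counting

count : ∀ {A : Set} {k} → (A → Fin k) → List A → Fin k → ℕ
count f xs i = length (filter (λ x → f x ≟ i) xs)

module _ {A : Set} {k : ℕ} where

  count-cong : ∀ {l} {f : A → Fin k} {g : A → Fin l} {i j} xs →
    (∀ {x} → x ∈ xs → (f x ≡ i → g x ≡ j) × (g x ≡ j → f x ≡ i)) →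
    count f xs i ≡ count g xs j
  count-cong [] h = refl
  count-cong {f = f} {g} {i} {j} (x ∷ xs) h with f x ≟ i | g x ≟ j
  ... | yes _ | yes _ = cong suc (count-cong xs (h ∘ there))
  ... | no  _ | no  _ = count-cong xs (h ∘ there)
  ... | yes p | no ¬q = contradiction (proj₁ (h (here refl)) p) ¬q
  ... | no ¬p | yes q = contradiction (proj₂ (h (here refl)) q) ¬p

  count-agree : ∀ {f g : A → Fin k} {i} xs → (∀ {x} → x ∈ xs → f x ≡ g x) →
    count f xs i ≡ count g xs i
  count-agree xs h = count-cong xs λ x∈ → trans (sym (h x∈)) , trans (h x∈)

  ∈-tail : ∀ {x y : A} {xs} → All (x ≢_) xs → y ∈ xs → y ≢ x
  ∈-tail x∉ y∈ y≡x = All.lookup x∉ y∈ (sym y≡x)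

  -- Exchanging `f` and `g` gives the two effects of a recolouring: the old colour loses one
  -- occurrence, the new one gains one. Uniqueness of the list keeps the change at exactly one.
  count-recolour : ∀ {f g : A → Fin k} {i y xs} → Unique xs → y ∈ xs →
    f y ≡ i → g y ≢ i → (∀ {x} → x ∈ xs → x ≢ y → f x ≡ g x) →
    count f xs i ≡ suc (count g xs i)
  count-recolour {f} {g} {i} {y} {x ∷ xs} (x∉ ∷ u) y∈ p q h with f x ≟ i | g x ≟ i | y∈
  ... | yes _  | yes q′ | here refl = contradiction q′ q
  ... | no ¬p  | _      | here refl = contradiction p ¬p
  ... | yes _  | no _   | here refl = cong suc (count-agree xs λ z∈ → h (there z∈) (∈-tail x∉ z∈))
  ... | yes _  | yes _  | there y∈′ = cong suc (count-recolour u y∈′ p q (h ∘ there))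
  ... | no _   | no _   | there y∈′ = count-recolour u y∈′ p q (h ∘ there)
  ... | yes p′ | no ¬q′ | there y∈′ =
    contradiction (trans (sym (h (here refl) (∈-tail x∉ y∈′ ∘ sym))) p′) ¬q′
  ... | no ¬p′ | yes q′ | there y∈′ =
    contradiction (trans (h (here refl) (∈-tail x∉ y∈′ ∘ sym)) q′) ¬p′

  count-none : ∀ {f : A → Fin k} {i} xs → (∀ {x} → x ∈ xs → f x ≢ i) → count f xs i ≡ 0
  count-none {f} {i} xs h = cong length (filter-none (λ x → f x ≟ i) (All.tabulate h))

  count-unique : ∀ {f : A → Fin k} {i y xs} → Unique xs → y ∈ xs → f y ≡ i →
    (∀ {x} → x ∈ xs → f x ≡ i → x ≡ y) → count f xs i ≡ 1
  count-unique {f} {i} {y} {x ∷ xs} (x∉ ∷ u) y∈ p h with f x ≟ i | y∈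
  ... | yes p′ | _ = cong suc (count-none xs λ z∈ q →
          ∈-tail x∉ z∈ (trans (h (there z∈) q) (sym (h (here refl) p′))))
  ... | no ¬p | here refl = contradiction p ¬p
  ... | no _  | there y∈′ = count-unique u y∈′ p (h ∘ there)

  count-map : ∀ {B : Set} (f : A → Fin k) (h : B → A) i xs →
    count f (map h xs) i ≡ count (f ∘ h) xs i
  count-map f h i [] = refl
  count-map f h i (x ∷ xs) with does (f (h x) ≟ i)
  ... | true  = cong suc (count-map f h i xs)
  ... | false = count-map f h i xs

lookup-injective : ∀ {A : Set} {xs : List A} → Unique xs →
  ∀ i j → lookup xs i ≡ lookup xs j → i ≡ j
lookup-injective (_ ∷ _)  zero    zero    _ = refl
lookup-injective (x∉ ∷ _) zero    (suc j) p = contradiction p (All.lookup x∉ (∈-lookup j))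
lookup-injective (x∉ ∷ _) (suc i) zero    p = contradiction (sym p) (All.lookup x∉ (∈-lookup i))
lookup-injective (_ ∷ u)  (suc i) (suc j) p = cong suc (lookup-injective u i j p)

parity-suc : ∀ {a b} → a ≡ suc b → parity a ≡ 0ℙ → parity b ≡ 1ℙ
parity-suc {b = suc zero}    refl p = refl
parity-suc {b = suc (suc b)} refl p = parity-suc {b = b} refl p

parity-suc′ : ∀ {a b} → a ≡ suc b → parity b ≡ 0ℙ → parity a ≡ 1ℙ
parity-suc′ {b = zero}        refl p = refl
parity-suc′ {b = suc (suc b)} refl p = parity-suc′ {b = b} refl p

parity-0≢1 : ∀ a → parity a ≡ 0ℙ → parity a ≡ 1ℙ → ⊥
parity-0≢1 _ p q with () ← trans (sym p) q

tabulate-+ : ∀ {A : Set} n {m} (f : Fin (n + m) → A) →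
  tabulate f ≡ tabulate (f ∘ (_↑ˡ m)) ++ tabulate (f ∘ (n ↑ʳ_))
tabulate-+ zero    f = refl
tabulate-+ (suc n) f = cong (f zero ∷_) (tabulate-+ n (f ∘ suc))

filter-map-≐ : ∀ {A B : Set} {P : Pred A 0ℓ} {Q : Pred B 0ℓ} (P? : Decidable P) (Q? : Decidable Q)
  (h : B → A) → (∀ x → P (h x) → Q x) → (∀ x → Q x → P (h x)) →
  ∀ xs → filter P? (map h xs) ≡ map h (filter Q? xs)
filter-map-≐ P? Q? h to from [] = refl
filter-map-≐ P? Q? h to from (x ∷ xs) with P? (h x) | Q? x
... | yes _ | yes _ = cong (h x ∷_) (filter-map-≐ P? Q? h to from xs)
... | no _  | no _  = filter-map-≐ P? Q? h to from xs
... | yes p | no ¬q = contradiction (to x p) ¬q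
... | no ¬p | yes q = contradiction (from x q) ¬p

-- Existence of least values

-- A bound on a parameter includes the existence of its value; the minimum is found by searching
-- upwards from 0.
least : ∀ {P : ℕ → Set} → Decidable P → ∀ b → P b → IsLeast P ≤ᵛ b
least P? b Pb with P? 0
least P? b       Pb | yes P0 = 0 , (P0 , λ _ _ → z≤n) , z≤n
least P? zero    Pb | no ¬P0 = contradiction Pb ¬P0
least P? (suc b) Pb | no ¬P0 with least (P? ∘ suc) b Pb
... | k , (Pk , min) , k≤b =
  suc k , (Pk , λ { zero P0 → contradiction P0 ¬P0 ; (suc j) Pj → s≤s (min j Pj) }) , s≤s k≤b

-- The search runs over codes in `Fin (k ^ n)`. Decoding the code of `f` returns `f` only pointwise,
-- so `Q` must respect pointwise equality.
any-function? : ∀ {n k} {Q : (Fin n → Fin k) → Set} →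
  (∀ {f g} → f ≗ g → Q f → Q g) → Decidable Q → Dec (∃ Q)
any-function? {n} {k} resp Q? =
  map′ (λ (i , q) → finToFun i , q)
       (λ (f , q) → funToFin f , resp (λ x → sym (finToFun-funToFin f x)) q)
       (any? λ (i : Fin (k ℕ.^ n)) → Q? (finToFun i))

-- With odd parity or equality to 1 for `P`, this unfolds to `ProperOdd` or `ProperConflictFree`.
ProperWith : ∀ {n k} → Graph n → (ℕ → Set) → Coloring n k → Set
ProperWith H P c = Proper H c × (∀ v → NonIsolated H v → ∃[ i ] P (occurrences H c v i))

module _ {n : ℕ} (H : Graph n) {P : ℕ → Set} (P? : Decidable P) where

  properWith? : ∀ {k} → Decidable (ProperWith {k = k} H P)
  properWith? c =
    all? (λ u → all? λ v → adj? H u v →-dec ¬? (c u ≟ c v)) ×-dec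
    all? (λ v → any? (adj? H v) →-dec any? λ i → P? (occurrences H c v i))

  properWith-resp : ∀ {k} {c c′ : Coloring n k} → c ≗ c′ → ProperWith H P c → ProperWith H P c′
  properWith-resp c≗c′ (proper , cond) =
    (λ u v u~v p → proper u v u~v (trans (c≗c′ u) (trans p (sym (c≗c′ v))))) ,
    λ v ni → let i , p = cond v ni in
      i , subst P (count-agree (neighbours H v) λ {x} _ → c≗c′ x) p

  properWith-≤ᵛ : ∀ {k} → ∃ (ProperWith {k = k} H P) →
    (IsLeast λ j → ∃ (ProperWith {k = j} H P)) ≤ᵛ k
  properWith-≤ᵛ = least (λ j → any-function? properWith-resp properWith?) _

-- Edges of a graph and its subdivision

record EdgeList {n : ℕ} (G : Graph n) : Set where
  field
    m            : ℕ
    tail head    : Fin m → Fin n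
    tail<head    : ∀ e → tail e Fin.< head e
    tail~head    : ∀ e → Adj G (tail e) (head e)
    edge-unique  : ∀ {e e′} → tail e ≡ tail e′ → head e ≡ head e′ → e ≡ e′
    edge-exists  : ∀ {u v} → u Fin.< v → Adj G u v → ∃ λ e → u ≡ tail e × v ≡ head e

module Incidence {n : ℕ} {G : Graph n} (E : EdgeList G) where

  open EdgeList E public

  IsEnd : Fin n → Fin m → Set
  IsEnd v e = v ≡ tail e ⊎ v ≡ head e

  opaque
    -- If `v` is not an end of `e`, the value `tail e` is a placeholder.
    other : Fin n → Fin m → Fin n
    other v e = if does (v ≟ tail e) then head e else tail e

    other-tail : ∀ e → other (tail e) e ≡ head e
    other-tail e with tail e ≟ tail e
    ... | yes _ = refl
    ... | no ¬p = contradiction refl ¬p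

    other-head : ∀ e → other (head e) e ≡ tail e
    other-head e with head e ≟ tail e
    ... | yes p = contradiction (sym p) (<⇒≢ (tail<head e))
    ... | no _  = refl

    end? : ∀ v → Decidable (IsEnd v)
    end? v e = (v ≟ tail e) ⊎-dec (v ≟ head e)

  other-end : ∀ {v e} → IsEnd v e → IsEnd (other v e) e
  other-end {e = e} (inj₁ refl) = inj₂ (other-tail e)
  other-end {e = e} (inj₂ refl) = inj₁ (other-head e)

  other-other : ∀ {v e} → IsEnd v e → other (other v e) e ≡ v
  other-other {e = e} (inj₁ refl) = trans (cong (λ u → other u e) (other-tail e)) (other-head e)
  other-other {e = e} (inj₂ refl) = trans (cong (λ u → other u e) (other-head e)) (other-tail e)

  other-adj : ∀ {v e} → IsEnd v e → Adj G v (other v e)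
  other-adj {e = e} (inj₁ refl) = subst (Adj G (tail e)) (sym (other-tail e)) (tail~head e)
  other-adj {e = e} (inj₂ refl) =
    subst (Adj G (head e)) (sym (other-head e)) (Graph.sym G (tail~head e))

  other≢ : ∀ {v e} → IsEnd v e → other v e ≢ v
  other≢ v∈e p = Graph.irrefl G (sym p) (other-adj v∈e)

  end-cases : ∀ {u v e} → IsEnd u e → IsEnd v e → v ≡ u ⊎ v ≡ other u e
  end-cases         (inj₁ refl) (inj₁ q)    = inj₁ q
  end-cases {e = e} (inj₁ refl) (inj₂ refl) = inj₂ (sym (other-tail e))
  end-cases {e = e} (inj₂ refl) (inj₁ refl) = inj₂ (sym (other-head e))
  end-cases         (inj₂ refl) (inj₂ q)    = inj₁ q

  ends-unique : ∀ {u v e e′} → u ≢ v → IsEnd u e → IsEnd v e → IsEnd u e′ → IsEnd v e′ → e ≡ e′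
  ends-unique {e = e} {e′} u≢v p q p′ q′ = go p q p′ q′
    where
    go : IsEnd _ e → IsEnd _ e → IsEnd _ e′ → IsEnd _ e′ → e ≡ e′
    go (inj₁ a) (inj₁ b) _ _ = contradiction (trans a (sym b)) u≢v
    go (inj₂ a) (inj₂ b) _ _ = contradiction (trans a (sym b)) u≢v
    go _ _ (inj₁ a) (inj₁ b) = contradiction (trans a (sym b)) u≢v
    go _ _ (inj₂ a) (inj₂ b) = contradiction (trans a (sym b)) u≢v
    go (inj₁ a) (inj₂ b) (inj₁ c) (inj₂ d) = edge-unique (trans (sym a) c) (trans (sym b) d)
    go (inj₂ a) (inj₁ b) (inj₂ c) (inj₁ d) = edge-unique (trans (sym b) d) (trans (sym a) c)
    -- The same ends in crossed order would contradict `tail<head`.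
    go (inj₁ a) (inj₂ b) (inj₂ c) (inj₁ d) = contradiction
      (subst₂ Fin._<_ (trans (sym d) b) (trans (sym c) a) (tail<head e′)) (<-asym (tail<head e))
    go (inj₂ a) (inj₁ b) (inj₁ c) (inj₂ d) = contradiction
      (subst₂ Fin._<_ (trans (sym c) a) (trans (sym d) b) (tail<head e′)) (<-asym (tail<head e))

  incident : Fin n → List (Fin m)
  incident v = filter (end? v) (allFin m)

  ∈-incident : ∀ {v e} → IsEnd v e → e ∈ incident v
  ∈-incident {v} {e} = ∈-filter⁺ (end? v) (∈-allFin e)

  incident-∈ : ∀ {v e} → e ∈ incident v → IsEnd v e
  incident-∈ {v} e∈ = proj₂ (∈-filter⁻ (end? v) {xs = allFin m} e∈)

  incident-unique : ∀ v → Unique (incident v)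
  incident-unique v = Unique.filter⁺ (end? v) (Unique.allFin⁺ m)

  edge-between : ∀ {u v} → Adj G u v → ∃ λ e → IsEnd u e × IsEnd v e
  edge-between {u} {v} u~v with <-cmp u v
  ... | tri≈ _ u≡v _ = ⊥-elim (Graph.irrefl G u≡v u~v)
  ... | tri< u<v _ _ = let e , p , q = edge-exists u<v u~v in e , inj₁ p , inj₂ q
  ... | tri> _ _ v<u = let e , p , q = edge-exists v<u (Graph.sym G u~v) in e , inj₂ q , inj₁ p

  -- The second component makes the combined colouring of `S G` proper; the first gives every
  -- subdividing vertex two neighbours of different colours.
  Valid : ∀ {k} → (Fin n → Fin k) → (Fin m → Fin k) → Set
  Valid c d = (∀ {v e} → IsEnd v e → c v ≢ c (other v e)) × (∀ {v e} → IsEnd v e → c v ≢ d e)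

edgeList : ∀ {n} (G : Graph n) → EdgeList G
edgeList {n} G = record
  { m           = length (edges G)
  ; tail        = proj₁ ∘ lookup (edges G)
  ; head        = proj₂ ∘ lookup (edges G)
  ; tail<head   = proj₁ ∘ edge-spec
  ; tail~head   = proj₂ ∘ edge-spec
  ; edge-unique = λ p q → lookup-injective
      (Unique.filter⁺ edge? (Unique.cartesianProduct⁺ (Unique.allFin⁺ n) (Unique.allFin⁺ n)))
      _ _ (cong₂ _,_ p q)
  ; edge-exists = λ {u} {v} u<v u~v →
      let uv∈ = ∈-filter⁺ edge? (∈-cartesianProduct⁺ (∈-allFin u) (∈-allFin v)) (u<v , u~v)
      in Any.index uv∈ , cong proj₁ (lookup-index uv∈) , cong proj₂ (lookup-index uv∈)
  }
  where
  edge? : Decidable {A = Fin n × Fin n} λ (u , v) → (u Fin.< v) × Adj G u v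
  edge? (u , v) = (u <? v) ×-dec adj? G u v

  edge-spec : ∀ e → let u , v = lookup (edges G) e in (u Fin.< v) × Adj G u v
  edge-spec e = proj₂ (∈-filter⁻ edge? {xs = cartesianProduct (allFin n) (allFin n)}
                                  (∈-lookup {xs = edges G} e))

-- Colourings of the subdivision from vertex and edge colours

module SubdivisionColouring {n : ℕ} (G : Graph n) where

  -- For this list, `IsEnd` is by definition the adjacency in `S G`, once `splitAt` is evaluated.
  open Incidence (edgeList G)

  neighbours-vertex : ∀ v → neighbours (S G) (v ↑ˡ m) ≡ map (n ↑ʳ_) (incident v)
  neighbours-vertex v = begin
    filter P? (tabulate id)                                         ≡⟨ cong (filter P?) (tabulate-+ n id) ⟩
    filter P? (tabulate (_↑ˡ m) ++ tabulate (n ↑ʳ_))                ≡⟨ filter-++ P? (tabulate (_↑ˡ m)) _ ⟩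
    filter P? (tabulate (_↑ˡ m)) ++ filter P? (tabulate (n ↑ʳ_))    ≡⟨ cong₂ _++_
        (filter-none P? (tabulate⁺ λ u → not-vertex u))
        (trans (cong (filter P?) (sym (map-tabulate id (n ↑ʳ_))))
               (filter-map-≐ P? (end? v) (n ↑ʳ_) to from (allFin m))) ⟩
    map (n ↑ʳ_) (incident v)                                        ∎
    where
    open ≡-Reasoning
    P? = adj? (S G) (v ↑ˡ m)
    not-vertex : ∀ u → ¬ Adj (S G) (v ↑ˡ m) (u ↑ˡ m)
    not-vertex u p rewrite splitAt-↑ˡ n v m | splitAt-↑ˡ n u m = p
    to : ∀ e → Adj (S G) (v ↑ˡ m) (n ↑ʳ e) → IsEnd v e
    to e p rewrite splitAt-↑ˡ n v m | splitAt-↑ʳ n m e = p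
    from : ∀ e → IsEnd v e → Adj (S G) (v ↑ˡ m) (n ↑ʳ e)
    from e p rewrite splitAt-↑ˡ n v m | splitAt-↑ʳ n m e = p

  colouring : ∀ {k} → (Fin n → Fin k) → (Fin m → Fin k) → Coloring (n + m) k
  colouring c d x = [ c , d ]′ (splitAt n x)

  colouring-vertex : ∀ {k} {c : Fin n → Fin k} {d} v → colouring c d (v ↑ˡ m) ≡ c v
  colouring-vertex v rewrite splitAt-↑ˡ n v m = refl

  colouring-edge : ∀ {k} {c : Fin n → Fin k} {d} e → colouring c d (n ↑ʳ e) ≡ d e
  colouring-edge e rewrite splitAt-↑ʳ n m e = refl

  occurrences-vertex : ∀ {k} (c : Fin n → Fin k) d v i →
    occurrences (S G) (colouring c d) (v ↑ˡ m) i ≡ count d (incident v) i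
  occurrences-vertex c d v i = begin
    count (colouring c d) (neighbours (S G) (v ↑ˡ m)) i   ≡⟨ cong (λ xs → count (colouring c d) xs i) (neighbours-vertex v) ⟩
    count (colouring c d) (map (n ↑ʳ_) (incident v)) i    ≡⟨ count-map (colouring c d) (n ↑ʳ_) i (incident v) ⟩
    count (colouring c d ∘ (n ↑ʳ_)) (incident v) i        ≡⟨ count-agree (incident v) (λ {e} _ → colouring-edge {c = c} {d} e) ⟩
    count d (incident v) i                                ∎
    where open ≡-Reasoning

  data View : Fin (n + m) → Set where
    vertex : ∀ v → View (v ↑ˡ m)
    edge   : ∀ e → View (n ↑ʳ e)

  view : ∀ x → View x
  view x with splitAt n x in eq
  ... | inj₁ v = subst View (splitAt⁻¹-↑ˡ eq) (vertex v)
  ... | inj₂ e = subst View (splitAt⁻¹-↑ʳ eq) (edge e)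

  occurrences-edge : ∀ {k} {c : Fin n → Fin k} {d} → Valid c d → ∀ e →
    occurrences (S G) (colouring c d) (n ↑ʳ e) (c (tail e)) ≡ 1
  occurrences-edge {c = c} {d} (proper , _) e =
    count-unique (Unique.filter⁺ (adj? (S G) (n ↑ʳ e)) (Unique.allFin⁺ (n + m)))
                 (∈-filter⁺ (adj? (S G) (n ↑ʳ e)) (∈-allFin (tail e ↑ˡ m)) tail-adj)
                 (colouring-vertex {c = c} {d} (tail e))
                 only-tail
    where
    tail-adj : Adj (S G) (n ↑ʳ e) (tail e ↑ˡ m)
    tail-adj rewrite splitAt-↑ʳ n m e | splitAt-↑ˡ n (tail e) m = inj₁ refl
    only-tail′ : ∀ {x} → View x → Adj (S G) (n ↑ʳ e) x →
      colouring c d x ≡ c (tail e) → x ≡ tail e ↑ˡ m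
    only-tail′ (vertex v) p q rewrite splitAt-↑ʳ n m e | splitAt-↑ˡ n v m with p
    ... | inj₁ refl = refl
    ... | inj₂ refl = contradiction (trans (sym q) (cong c (sym (other-tail e)))) (proper (inj₁ refl))
    only-tail′ (edge e′) p q rewrite splitAt-↑ʳ n m e | splitAt-↑ʳ n m e′ = ⊥-elim p
    only-tail : ∀ {x} → x ∈ neighbours (S G) (n ↑ʳ e) →
      colouring c d x ≡ c (tail e) → x ≡ tail e ↑ˡ m
    only-tail {x} x∈ = only-tail′ (view x)
      (proj₂ (∈-filter⁻ (adj? (S G) (n ↑ʳ e)) {xs = allFin (n + m)} x∈))

  colouring-proper : ∀ {k} {c : Fin n → Fin k} {d} → Valid c d → Proper (S G) (colouring c d)
  colouring-proper {c = c} {d} (_ , valid) x y = go (view x) (view y)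
    where
    go : ∀ {x y} → View x → View y → Adj (S G) x y → colouring c d x ≢ colouring c d y
    go (vertex u) (vertex v) p rewrite splitAt-↑ˡ n u m | splitAt-↑ˡ n v m = ⊥-elim p
    go (edge e) (edge e′) p rewrite splitAt-↑ʳ n m e | splitAt-↑ʳ n m e′ = ⊥-elim p
    go (vertex v) (edge e) p rewrite splitAt-↑ˡ n v m | splitAt-↑ʳ n m e = valid p
    go (edge e) (vertex v) p rewrite splitAt-↑ˡ n v m | splitAt-↑ʳ n m e = valid p ∘ sym

  nonIsolated-vertex : ∀ v → NonIsolated (S G) (v ↑ˡ m) → ∃ λ e → IsEnd v e
  nonIsolated-vertex v (x , p) = go (view x) p
    where
    go : ∀ {x} → View x → Adj (S G) (v ↑ˡ m) x → ∃ λ e → IsEnd v e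
    go (vertex u) p rewrite splitAt-↑ˡ n v m | splitAt-↑ˡ n u m = ⊥-elim p
    go (edge e) p rewrite splitAt-↑ˡ n v m | splitAt-↑ʳ n m e = e , p

  -- A subdividing vertex sees the colour of the tail exactly once, so `P 1` settles it and only the
  -- counts at vertices of `G` remain.
  colouring-properWith : ∀ {k} {c : Fin n → Fin k} {d} (P : ℕ → Set) → P 1 → Valid c d →
    (∀ {v e} → IsEnd v e → ∃ λ i → P (count d (incident v) i)) →
    ProperWith (S G) P (colouring c d)
  colouring-properWith {c = c} {d} P P1 valid h = colouring-proper valid , λ x → go (view x)
    where
    go : ∀ {x} → View x → NonIsolated (S G) x → ∃ λ i → P (occurrences (S G) (colouring c d) x i)
    go (vertex v) ni with _ , p ← nonIsolated-vertex v ni with i , q ← h p =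
      i , subst P (sym (occurrences-vertex c d v i)) q
    go (edge e) _ = c (tail e) , subst P (sym (occurrences-edge valid e)) P1

-- Odd colourings

opaque
  fourth : ∀ (x y z : Fin 4) → ∃ λ w → w ≢ x × w ≢ y × w ≢ z
  fourth = toWitness {a? = all? λ x → all? λ y → all? λ z → any? λ w →
    ¬? (w ≟ x) ×-dec ¬? (w ≟ y) ×-dec ¬? (w ≟ z)} tt

  fourth-unique : ∀ (x y z : Fin 4) → x ≢ y → x ≢ z → y ≢ z → ∀ w → w ≢ x → w ≢ y → w ≢ z →
    ∀ w′ → w′ ≢ x → w′ ≢ y → w′ ≢ z → w ≡ w′
  fourth-unique = toWitness {a? = all? λ x → all? λ y → all? λ z →
    ¬? (x ≟ y) →-dec ¬? (x ≟ z) →-dec ¬? (y ≟ z) →-dec all? λ w →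
    ¬? (w ≟ x) →-dec ¬? (w ≟ y) →-dec ¬? (w ≟ z) →-dec all? λ w′ →
    ¬? (w′ ≟ x) →-dec ¬? (w′ ≟ y) →-dec ¬? (w′ ≟ z) →-dec (w ≟ w′)} tt

module OddColouring {n : ℕ} {G : Graph n} (E : EdgeList G) where

  open Incidence E

  -- A vertex without edges sees every colour zero times; the first component keeps it from being
  -- bad.
  Bad : (Fin m → Fin 4) → Fin n → Set
  Bad d v = (∃ λ e → IsEnd v e) × (∀ i → parity (count d (incident v) i) ≡ 0ℙ)

  opaque
    bad? : ∀ d → Decidable (Bad d)
    bad? d v = any? (end? v) ×-dec all? λ i → parity (count d (incident v) i) ℙ.≟ 0ℙ

  bad-cong : ∀ {d d′ v} → (∀ {e} → IsEnd v e → d e ≡ d′ e) → Bad d v → Bad d′ v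
  bad-cong {v = v} h (∃e , even) =
    ∃e , λ i → trans (cong parity (sym (count-agree (incident v) (h ∘ incident-∈)))) (even i)

  -- The old colour of `e` loses exactly one occurrence at `v`, so its count cannot be even both
  -- before and after.
  recolour-bad : ∀ {d d′ v e} → IsEnd v e → (∀ {e′} → IsEnd v e′ → e′ ≢ e → d e′ ≡ d′ e′) →
    d e ≢ d′ e → Bad d v → ¬ Bad d′ v
  recolour-bad {d} {d′} {v} {e} v∈e agree d≢d′ (_ , even) (_ , even′) =
    parity-0≢1 (count d′ (incident v) (d e)) (even′ (d e)) (parity-suc
      (count-recolour (incident-unique v) (∈-incident v∈e) refl (d≢d′ ∘ sym) (agree ∘ incident-∈))
      (even (d e)))

  opaque
    -- If `c` is proper and `x` is admissible on `e`, the three excluded colours are distinct and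
    -- this is the other admissible colour.
    alt : (Fin n → Fin 4) → Fin m → Fin 4 → Fin 4
    alt c e x = proj₁ (fourth (c (tail e)) (c (head e)) x)

    alt≢end : ∀ {c v e x} → IsEnd v e → c v ≢ alt c e x
    alt≢end {c} {e = e} {x} (inj₁ refl) = proj₁ (proj₂ (fourth (c (tail e)) (c (head e)) x)) ∘ sym
    alt≢end {c} {e = e} {x} (inj₂ refl) = proj₁ (proj₂ (proj₂ (fourth (c (tail e)) (c (head e)) x))) ∘ sym

    alt≢ : ∀ {c e x} → x ≢ alt c e x
    alt≢ {c} {e} {x} = proj₂ (proj₂ (proj₂ (fourth (c (tail e)) (c (head e)) x))) ∘ sym

  flip : (Fin n → Fin 4) → (Fin m → Fin 4) → Fin m → (Fin m → Fin 4)
  flip c d e = updateAt d e (alt c e)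

  flip-at : ∀ {c d} e → flip c d e e ≡ alt c e (d e)
  flip-at {d = d} e = updateAt-updates e d

  flip-off : ∀ {c d e e′} → e′ ≢ e → flip c d e e′ ≡ d e′
  flip-off {d = d} {e} {e′} = updateAt-minimal e′ e d

  flip-valid : ∀ {c d} → Valid c d → ∀ e → Valid c (flip c d e)
  flip-valid {c} {d} (proper , valid) e = proper , go
    where
    go : ∀ {v e′} → IsEnd v e′ → c v ≢ flip c d e e′
    go {v} {e′} v∈e′ p with e′ ≟ e
    ... | yes refl = alt≢end {x = d e} v∈e′ (trans p (flip-at e))
    ... | no e′≢e = valid v∈e′ (trans p (flip-off e′≢e))

  alt-alt : ∀ {c d} → Valid c d → ∀ e → alt c e (alt c e (d e)) ≡ d e
  alt-alt {c} {d} (proper , valid) e = fourth-unique (c (tail e)) (c (head e)) (alt c e (d e))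
    (λ p → proper (inj₁ refl) (trans p (cong c (sym (other-tail e)))))
    (alt≢end {x = d e} (inj₁ refl)) (alt≢end {x = d e} (inj₂ refl))
    _ (alt≢end {x = alt c e (d e)} (inj₁ refl) ∘ sym) (alt≢end {x = alt c e (d e)} (inj₂ refl) ∘ sym) (alt≢ ∘ sym)
    _ (valid (inj₁ refl) ∘ sym) (valid (inj₂ refl) ∘ sym) alt≢

  -- The switch changes the parities of exactly two colours at `v`, the old and the new colour of
  -- `e`. Together with `flip-bad-even`: if it would spoil `v`, these two are just the odd colours
  -- under `d`.
  flip-bad-odd : ∀ {c d v e i} → IsEnd v e → Bad (flip c d e) v → i ≡ d e ⊎ i ≡ alt c e (d e) →
    parity (count d (incident v) i) ≡ 1ℙ
  flip-bad-odd {c} {d} {v} {e} v∈e (_ , even) (inj₁ refl) = parity-suc′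
    (count-recolour (incident-unique v) (∈-incident v∈e) refl
      (λ p → alt≢ (sym (trans (sym (flip-at e)) p))) (λ _ → sym ∘ flip-off))
    (even _)
  flip-bad-odd {c} {d} {v} {e} v∈e (_ , even) (inj₂ refl) = parity-suc
    (count-recolour (incident-unique v) (∈-incident v∈e) (flip-at e) alt≢ (λ _ → flip-off))
    (even _)

  flip-bad-even : ∀ {c d v e i} → Bad (flip c d e) v → i ≢ d e → i ≢ alt c e (d e) →
    parity (count d (incident v) i) ≡ 0ℙ
  flip-bad-even {c} {d} {v} {e} {i} (_ , even) p q =
    trans (cong parity (count-cong (incident v) λ {e′} _ → same e′)) (even i)
    where
    same : ∀ e′ → (d e′ ≡ i → flip c d e e′ ≡ i) × (flip c d e e′ ≡ i → d e′ ≡ i)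
    same e′ with e′ ≟ e
    ... | yes refl = (λ r → contradiction (sym r) p) ,
                     (λ r → contradiction (trans (sym r) (flip-at e)) q)
    ... | no e′≢e = trans (flip-off e′≢e) , trans (sym (flip-off e′≢e))

  -- The colours that v sees an odd number of times are the two admissible
  -- colours of e, and likewise of f, so e and f have the same two.
  flips-bad : ∀ {c d v e f} → Valid c d → IsEnd v e → IsEnd v f →
    Bad (flip c d e) v → Bad (flip c d f) v → c (other v e) ≡ c (other v f)
  flips-bad {c} {d} {v} {e} {f} (proper , valid) v∈e v∈f bad-e bad-f =
    -- Both far ends avoid the two admissible colours of `e` and the colour of `v`, which leaves a
    -- single colour.
    fourth-unique (d e) (alt c e (d e)) (c v)
      alt≢ (valid v∈e ∘ sym) (alt≢end {x = d e} v∈e ∘ sym)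
      _ (valid (other-end v∈e)) (alt≢end {x = d e} (other-end v∈e)) (proper v∈e ∘ sym)
      _ (absurd ∘ inj₁) (absurd ∘ inj₂) (proper v∈f ∘ sym)
    where
    absurd : ¬ (c (other v f) ≡ d e ⊎ c (other v f) ≡ alt c e (d e))
    absurd p = parity-0≢1 (count d (incident v) (c (other v f)))
      (flip-bad-even bad-f (valid (other-end v∈f)) (alt≢end {x = d f} (other-end v∈f)))
      (flip-bad-odd v∈e bad-e p)

  -- A switch away from `u` does not affect what switching `f` would do at `u`. This carries the
  -- recorded departures through later moves.
  flip-flip : ∀ {c d u e f g} → ¬ IsEnd u e → IsEnd u f → IsEnd u g →
    flip c d f g ≡ flip c (flip c d e) f g
  flip-flip {c} {d} {u} {e} {f} {g} u∉e u∈f u∈g with g ≟ f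
  ... | yes refl = trans (flip-at g) (trans (cong (alt c g) (sym (flip-off (avoids u∈g)))) (sym (flip-at g)))
    where
    avoids : ∀ {h} → IsEnd u h → h ≢ e
    avoids u∈h refl = u∉e u∈h
  ... | no g≢f = trans (flip-off g≢f) (trans (sym (flip-off (λ { refl → u∉e u∈g }))) (sym (flip-off g≢f)))

  -- By `recolour-bad` the vertex `v` becomes good, and the far end is the only other vertex whose
  -- counts change. The list `B` bounds the bad vertices still waiting.
  move : ∀ {c d v e B} → IsEnd v e → Bad d v → (∀ {x} → Bad d x → x ≡ v ⊎ x ∈ B) →
    ∀ {x} → Bad (flip c d e) x → x ≡ other v e ⊎ x ∈ B
  move {c} {d} {v} {e} {B} v∈e bad-v bads {x} bad-x with end? x e
  ... | yes x∈e with end-cases v∈e x∈e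
  ...   | inj₁ refl = contradiction bad-x
            (recolour-bad v∈e (λ _ → sym ∘ flip-off) (λ p → alt≢ (trans p (flip-at e))) bad-v)
  ...   | inj₂ p = inj₁ p
  move {c} {d} {v} {e} {B} v∈e bad-v bads {x} bad-x | no x∉e
    with bads (bad-cong (λ x∈e′ → flip-off λ { refl → x∉e x∈e′ }) bad-x)
  ... | inj₁ refl = contradiction v∈e x∉e
  ... | inj₂ x∈B = inj₂ x∈B

  Improvement : List (Fin n) → Set
  Improvement B = ∃₂ λ c d → Valid c d × (∀ {x} → Bad d x → x ∈ B)

  -- Let e₁ be an edge at r, of colour x, whose switch to the other admissible
  -- colour y would spoil its far end. After recolouring r with y, the edges at r
  -- may take the old colour a of r and x. At the far end of each edge one of the
  -- two is harmless, on e₁ both are, and one choice on e₁ makes r good.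
  improve-monochromatic : ∀ {c d r b B} → Valid c d → Bad d r →
    (∀ {e} → IsEnd r e → c (other r e) ≡ b) →
    (∀ {x} → Bad d x → x ≡ r ⊎ x ∈ B) → Improvement B
  improve-monochromatic {c} {d} {r} {b} {B} (proper , valid) bad-r@((e₁ , r∈e₁) , _) mono bads
    with bad? (flip c d e₁) (other r e₁)
  ... | no ¬bad = c , flip c d e₁ , flip-valid (proper , valid) e₁ , bads′
    where
    bads′ : ∀ {x} → Bad (flip c d e₁) x → x ∈ B
    bads′ bad-x with move r∈e₁ bad-r bads bad-x
    ... | inj₁ refl = contradiction bad-x ¬bad
    ... | inj₂ x∈B = x∈B
  ... | yes bad₁ = result
    where
    a x y : Fin 4
    a = c r
    x = d e₁
    y = alt c e₁ x

    Allowed : Fin 4 → Set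
    Allowed t = t ≢ y × t ≢ b

    a-allowed : Allowed a
    a-allowed = alt≢end {x = x} r∈e₁ , λ p → proper r∈e₁ (trans p (sym (mono r∈e₁)))

    x-allowed : Allowed x
    x-allowed = alt≢ , λ p → valid (other-end r∈e₁) (trans (mono r∈e₁) (sym p))

    y≢b : y ≢ b
    y≢b p = alt≢end {x = x} (other-end r∈e₁) (trans (mono r∈e₁) (sym p))

    a≢x : a ≢ x
    a≢x = valid r∈e₁

    Good : Fin m → Fin 4 → Set
    Good e t = ¬ Bad (updateAt d e (const t)) (other r e)

    opaque
      choose : ∀ e → ∃ λ t → Allowed t × (IsEnd r e → Good e t)
      choose e with bad? (updateAt d e (const a)) (other r e)
      ... | no ¬bad = a , a-allowed , λ _ → ¬bad
      ... | yes bad = x , x-allowed , λ r∈e → recolour-bad (other-end r∈e)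
        (λ {e′} _ p → trans (updateAt-minimal e′ e d p) (sym (updateAt-minimal e′ e d p)))
        (λ p → a≢x (trans (sym (updateAt-updates e d)) (trans p (updateAt-updates e d)))) bad

    pick : Fin m → Fin 4
    pick e = proj₁ (choose e)

    pick-allowed : ∀ e → Allowed (pick e)
    pick-allowed e = proj₁ (proj₂ (choose e))

    pick-good : ∀ e → IsEnd r e → Good e (pick e)
    pick-good e = proj₂ (proj₂ (choose e))

    opaque
      D-spec : ∀ t e → ∃ λ s → (e ≡ e₁ → s ≡ t) × (IsEnd r e → e ≢ e₁ → s ≡ pick e) × (¬ IsEnd r e → s ≡ d e)
      D-spec t e with e ≟ e₁ | end? r e
      ... | yes refl | _      = t , (λ _ → refl) , (λ _ p → contradiction refl p) , contradiction r∈e₁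
      ... | no e≢e₁ | yes r∈e = pick e , (λ p → contradiction p e≢e₁) , (λ _ _ → refl) , contradiction r∈e
      ... | no e≢e₁ | no r∉e  = d e , (λ p → contradiction p e≢e₁) , (λ p → contradiction p r∉e) , λ _ → refl

    D : Fin 4 → Fin m → Fin 4
    D t e = proj₁ (D-spec t e)

    D-first : ∀ t → D t e₁ ≡ t
    D-first t = proj₁ (proj₂ (D-spec t e₁)) refl

    D-end : ∀ {t e} → IsEnd r e → e ≢ e₁ → D t e ≡ pick e
    D-end {t} {e} = proj₁ (proj₂ (proj₂ (D-spec t e)))

    D-off : ∀ {t e} → ¬ IsEnd r e → D t e ≡ d e
    D-off {t} {e} = proj₂ (proj₂ (proj₂ (D-spec t e)))

    D-allowed : ∀ {t e} → Allowed t → IsEnd r e → Allowed (D t e)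
    D-allowed {t} {e} ok r∈e with e ≟ e₁
    ... | yes refl = subst Allowed (sym (D-first t)) ok
    ... | no e≢e₁ = subst Allowed (sym (D-end r∈e e≢e₁)) (pick-allowed e)

    c′ : Fin n → Fin 4
    c′ = updateAt c r (const y)

    c′-off : ∀ {v} → v ≢ r → c′ v ≡ c v
    c′-off {v} v≢r = updateAt-minimal v r c v≢r

    c′-at : c′ r ≡ y
    c′-at = updateAt-updates r c

    c′-other : ∀ {e} → IsEnd r e → c′ (other r e) ≡ b
    c′-other r∈e = trans (c′-off (other≢ r∈e)) (mono r∈e)

    valid′ : ∀ {t} → Allowed t → Valid c′ (D t)
    valid′ {t} ok = proper′ , valid″
      where
      proper′ : ∀ {v e} → IsEnd v e → c′ v ≢ c′ (other v e)
      proper′ {v} {e} v∈e p with v ≟ r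
      ... | yes refl = y≢b (trans (sym c′-at) (trans p (c′-other v∈e)))
      ... | no v≢r with end? r e
      ...   | no r∉e = proper v∈e (trans (sym (c′-off v≢r)) (trans p (c′-off λ { refl → r∉e (other-end v∈e) })))
      ...   | yes r∈e with end-cases r∈e v∈e
      ...     | inj₁ v≡r = v≢r v≡r
      ...     | inj₂ refl = y≢b (sym (trans (sym (c′-other r∈e)) (trans p (trans (cong c′ (other-other r∈e)) c′-at))))
      valid″ : ∀ {v e} → IsEnd v e → c′ v ≢ D t e
      valid″ {v} {e} v∈e p with end? r e
      ... | no r∉e = valid v∈e (trans (sym (c′-off λ { refl → r∉e v∈e })) (trans p (D-off r∉e)))
      ... | yes r∈e with end-cases r∈e v∈e
      ...   | inj₁ refl = proj₁ (D-allowed ok r∈e) (trans (sym p) c′-at)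
      ...   | inj₂ refl = proj₂ (D-allowed ok r∈e) (trans (sym p) (c′-other r∈e))

    bads′ : ∀ {t v} → Allowed t → v ≢ r → Bad (D t) v → v ∈ B
    bads′ {t} {v} ok v≢r bad-v with any? (λ e → end? r e ×-dec end? v e)
    ... | no ∄e with bads (bad-cong (λ v∈e → D-off λ r∈e → ∄e (_ , r∈e , v∈e)) bad-v)
    ...   | inj₁ v≡r = contradiction v≡r v≢r
    ...   | inj₂ v∈B = v∈B
    bads′ {t} {v} ok v≢r bad-v | yes (e , r∈e , v∈e) with end-cases r∈e v∈e
    ... | inj₁ v≡r = contradiction v≡r v≢r
    ... | inj₂ refl with e ≟ e₁
    -- At the far end of `e₁` the colour `y` does the harm, and an allowed colour differs from `y`.
    ...   | yes refl = contradiction bad-v (recolour-bad v∈e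
              (λ v∈e′ p → trans (flip-off p) (sym (D-off λ r∈e′ → p (ends-unique v≢r v∈e′ r∈e′ v∈e r∈e))))
              (λ p → proj₁ ok (sym (trans (sym (flip-at e₁)) (trans p (D-first t))))) bad₁)
    ...   | no e≢e₁ = contradiction (bad-cong agree bad-v) (pick-good e r∈e)
      where
      agree : ∀ {e′} → IsEnd (other r e) e′ → D t e′ ≡ updateAt d e (const (pick e)) e′
      agree {e′} v∈e′ with e′ ≟ e
      ... | yes refl = trans (D-end r∈e e≢e₁) (sym (updateAt-updates e d))
      ... | no e′≢e = trans (D-off λ r∈e′ → e′≢e (ends-unique v≢r v∈e′ r∈e′ v∈e r∈e))
                            (sym (updateAt-minimal e′ e d e′≢e))

    finish : ∀ t → Allowed t → ¬ Bad (D t) r → Improvement B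
    finish t ok ¬bad = c′ , D t , valid′ ok , λ bad-x →
      bads′ ok (λ { refl → ¬bad bad-x }) bad-x

    result : Improvement B
    -- At `r`, the colourings `D a` and `D x` differ only on `e₁`, so `r` is good under one of them.
    result with bad? (D a) r
    ... | no ¬bad = finish a a-allowed ¬bad
    ... | yes bad = finish x x-allowed (recolour-bad r∈e₁
      (λ r∈e′ p → trans (D-end r∈e′ p) (sym (D-end r∈e′ p)))
      (λ p → a≢x (trans (sym (D-first a)) (trans p (D-first x)))) bad)

  -- U lists the unvisited vertices, and a visited u was last left through the
  -- edge nx u. The token is at v, which it has only reached from vertices
  -- of colour pc; by far-colour, it never leaves a vertex towards the colour from
  -- which it came.
  walk : ∀ k {U c d v pc B} (nx : Fin n → Fin m) → length U ≤ k →
    let far = λ u → other u (nx u) in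
    Valid c d → Bad d v → v ∈ U →
    (∀ {x} → Bad d x → x ≡ v ⊎ x ∈ B) →
    (∀ {u} → u ∉ U → IsEnd u (nx u)) →
    (∀ {u} → u ∉ U → far u ∉ U ⊎ far u ≡ v) →
    (∀ {u} → u ∉ U → Bad (flip c d (nx u)) u) →
    (∀ {u} → u ∉ U → far u ∉ U → c u ≢ c (far (far u))) →
    (∀ {u} → u ∉ U → far u ≡ v → c u ≡ pc) →
    Improvement B
  walk zero {U = []} nx _ _ _ ()
  walk (suc k) {U} {c} {d} {v} {pc} {B} nx ∣U∣≤k valid bad-v v∈U bads nx-end far-in nx-bad far-colour far-cur
    -- If there is no such edge, all neighbours of `v` have colour `pc`.
    with any? (λ e → end? v e ×-dec ¬? (c (other v e) ≟ pc))
  ... | no ∄e = improve-monochromatic valid bad-v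
        (λ {e} v∈e → decidable-stable (c (other v e) ≟ pc) λ p → ∄e (e , v∈e , p)) bads
  ... | yes (e , v∈e , cq≢pc) with bad? (flip c d e) (other v e)
  ...   | no ¬bad-q = c , flip c d e , flip-valid valid e , bads′
    where
    bads′ : ∀ {x} → Bad (flip c d e) x → x ∈ B
    bads′ bad-x with move v∈e bad-v bads bad-x
    ... | inj₁ refl = contradiction bad-x ¬bad-q
    ... | inj₂ x∈B = x∈B
  ...   | yes bad-q with member? _≟_ (other v e) U
  ...     | no q∉U = c , flip c d′ f , flip-valid (flip-valid valid e) f , bads′
    where
    q = other v e
    d′ = flip c d e
    f = nx q
    w = other q f
    q∈f : IsEnd q f
    q∈f = nx-end q∉U
    cv≡cw : c v ≡ c w
    cv≡cw = trans (cong c (sym (other-other v∈e)))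
                  (flips-bad valid (other-end v∈e) q∈f bad-q (nx-bad q∉U))
    w-good : ¬ Bad (flip c d′ f) w
    w-good bad-w with far-in q∉U
    -- Here `q` was left towards `v`, so it has colour `pc`, which the choice of `e` excluded.
    ... | inj₂ w≡v = cq≢pc (far-cur q∉U w≡v)
    -- Otherwise switching `f` and switching `nx w` would both spoil `w`, so their far ends `q` and
    -- `far w` would share a colour.
    ... | inj₁ w∉U = far-colour q∉U w∉U (trans (cong c (sym (other-other q∈f)))
            (flips-bad valid w∈f (nx-end w∉U) (bad-cong (sym ∘ flip-flip w∉e w∈f) bad-w) (nx-bad w∉U)))
      where
      w∈f : IsEnd w f
      w∈f = other-end q∈f
      w∉e : ¬ IsEnd w e
      w∉e w∈e with end-cases v∈e w∈e
      ... | inj₁ w≡v = w∉U (subst (_∈ U) (sym w≡v) v∈U)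
      ... | inj₂ w≡q = other≢ q∈f w≡q
    bads′ : ∀ {x} → Bad (flip c d′ f) x → x ∈ B
    bads′ bad-x with move q∈f bad-q (move v∈e bad-v bads) bad-x
    ... | inj₁ refl = contradiction bad-x w-good
    ... | inj₂ x∈B = x∈B
  -- The vertex `q` is new and is entered from `v`, so the colour to avoid next is `c v`.
  ...     | yes q∈U = walk k {U′} {c} {d′} {q} {c v} nx′
      (s≤s⁻¹ (ℕ.≤-trans (filter-notAll ≢v? U (lose v∈U λ p → p refl)) ∣U∣≤k))
      (flip-valid valid e) bad-q (∈-filter⁺ ≢v? q∈U (other≢ v∈e))
      (move v∈e bad-v bads) nx-end′ far-in′ nx-bad′ far-colour′ far-cur′
    where
    q = other v e
    d′ = flip c d e
    ≢v? : Decidable (_≢ v)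
    ≢v? u = ¬? (u ≟ v)
    U′ = filter ≢v? U
    nx′ = updateAt nx v (const e)
    far far′ : Fin n → Fin n
    far u = other u (nx u)
    far′ u = other u (nx′ u)
    nx-v : nx′ v ≡ e
    nx-v = updateAt-updates v nx
    nx-u : ∀ {u} → u ≢ v → nx′ u ≡ nx u
    nx-u {u} = updateAt-minimal u v nx
    far-v : far′ v ≡ q
    far-v = cong (other v) nx-v
    far-u : ∀ {u} → u ≢ v → far′ u ≡ far u
    far-u {u} p = cong (other u) (nx-u p)
    weaken : ∀ {u} → u ∉ U → u ∉ U′
    weaken u∉U u∈U′ = u∉U (proj₁ (∈-filter⁻ ≢v? {xs = U} u∈U′))
    v∉U′ : v ∉ U′
    v∉U′ v∈U′ = proj₂ (∈-filter⁻ ≢v? {xs = U} v∈U′) refl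
    q∈U′ : q ∈ U′
    q∈U′ = ∈-filter⁺ ≢v? q∈U (other≢ v∈e)
    ∉U⇒≢v : ∀ {u} → u ∉ U → u ≢ v
    ∉U⇒≢v u∉U refl = u∉U v∈U
    data Visited : Fin n → Set where
      now    : Visited v
      before : ∀ {u} → u ∉ U → u ≢ v → Visited u
    visited : ∀ {u} → u ∉ U′ → Visited u
    visited {u} u∉U′ with u ≟ v
    ... | yes refl = now
    ... | no u≢v = before (λ u∈U → u∉U′ (∈-filter⁺ ≢v? u∈U u≢v)) u≢v
    nx-end′ : ∀ {u} → u ∉ U′ → IsEnd u (nx′ u)
    nx-end′ {u} u∉U′ with visited u∉U′
    ... | now = subst (IsEnd v) (sym nx-v) v∈e
    ... | before u∉U u≢v = subst (IsEnd u) (sym (nx-u u≢v)) (nx-end u∉U)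
    far-in′ : ∀ {u} → u ∉ U′ → far′ u ∉ U′ ⊎ far′ u ≡ q
    far-in′ {u} u∉U′ with visited u∉U′
    ... | now = inj₂ far-v
    ... | before u∉U u≢v with far-in u∉U
    ...   | inj₁ p = inj₁ (subst (_∉ U′) (sym (far-u u≢v)) (weaken p))
    ...   | inj₂ p = inj₁ (subst (_∉ U′) (sym (trans (far-u u≢v) p)) v∉U′)
    nx-bad′ : ∀ {u} → u ∉ U′ → Bad (flip c d′ (nx′ u)) u
    nx-bad′ {u} u∉U′ with visited u∉U′
    -- Switching `e` back restores `d`, under which `v` is bad.
    ... | now = subst (λ f → Bad (flip c d′ f) v) (sym nx-v) (bad-cong (λ {g} _ → undo g) bad-v)
      where
      undo : ∀ g → d g ≡ flip c d′ e g
      undo g with g ≟ e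
      ... | yes refl = sym (trans (flip-at e) (trans (cong (alt c e) (flip-at e)) (alt-alt valid e)))
      ... | no g≢e = sym (trans (flip-off g≢e) (flip-off g≢e))
    ... | before u∉U u≢v = subst (λ f → Bad (flip c d′ f) u) (sym (nx-u u≢v))
            (bad-cong (flip-flip u∉e (nx-end u∉U)) (nx-bad u∉U))
      where
      u∉e : ¬ IsEnd u e
      u∉e u∈e with end-cases v∈e u∈e
      ... | inj₁ u≡v = u≢v u≡v
      ... | inj₂ refl = u∉U q∈U
    far-colour′ : ∀ {u} → u ∉ U′ → far′ u ∉ U′ → c u ≢ c (far′ (far′ u))
    far-colour′ {u} u∉U′ far∉U′ with visited u∉U′
    ... | now = contradiction (subst (_∈ U′) (sym far-v) q∈U′) far∉U′
    ... | before u∉U u≢v with far-in u∉U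
    ...   | inj₁ p = λ r → far-colour u∉U p
              (trans r (cong c (trans (cong far′ (far-u u≢v)) (far-u (∉U⇒≢v p)))))
    -- Here `u` was left towards `v` and has colour `pc`; after `v` comes `q`, whose colour is not
    -- `pc`.
    ...   | inj₂ p = λ r → cq≢pc (trans (cong c (sym far-v))
              (trans (cong (c ∘ far′) (sym (trans (far-u u≢v) p))) (trans (sym r) (far-cur u∉U p))))
    far-cur′ : ∀ {u} → u ∉ U′ → far′ u ≡ q → c u ≡ c v
    far-cur′ {u} u∉U′ far≡q with visited u∉U′
    ... | now = refl
    ... | before u∉U u≢v with far-in u∉U
    ...   | inj₁ p = contradiction (subst (_∈ U) (sym (trans (sym (far-u u≢v)) far≡q)) q∈U) p
    ...   | inj₂ p = contradiction (trans (sym far≡q) (trans (far-u u≢v) p)) (other≢ v∈e)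

  eliminate : ∀ B {c d} → Valid c d → (∀ {x} → Bad d x → x ∈ B) →
    ∃₂ λ c d → Valid c d × (∀ {x} → ¬ Bad d x)
  eliminate [] valid bads = _ , _ , valid , λ bad-x → contradiction (bads bad-x) λ ()
  eliminate (v ∷ B) {c} {d} valid bads with bad? d v
  ... | no ¬bad = eliminate B valid λ bad-x → drop-head bad-x (bads bad-x)
    where
    drop-head : ∀ {x} → Bad d x → x ∈ v ∷ B → x ∈ B
    drop-head bad-x (here refl) = contradiction bad-x ¬bad
    drop-head _     (there x∈B) = x∈B
  ... | yes bad-v@((e , _) , _) =
    -- All vertices start unvisited, so the invariants hold vacuously for an arbitrary `nx`. No
    -- neighbour of `v` has colour `c v`, so this `pc` leaves the first step free.
    let _ , _ , valid′ , bads′ = walk _ {allFin n} {pc = c v} (const e) ℕ.≤-refl valid bad-v (∈-allFin v)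
          (λ bad-x → split (bads bad-x)) (none _) (none _) (none _) (none _) (none _)
    in eliminate B valid′ bads′
    where
    split : ∀ {x} → x ∈ v ∷ B → x ≡ v ⊎ x ∈ B
    split (here p) = inj₁ p
    split (there p) = inj₂ p
    none : ∀ {A : Set} u → u ∉ allFin n → A
    none u u∉ = contradiction (∈-allFin u) u∉

  odd-colouring : (c : Fin n → Fin 4) → Proper G c →
    ∃₂ λ c d → Valid c d × (∀ {v e} → IsEnd v e → ∃ λ i → parity (count d (incident v) i) ≡ 1ℙ)
  odd-colouring c proper
    -- Any edge colours avoiding both ends will do as a start; the third excluded colour just
    -- repeats that of the head.
    with c′ , d , valid , good ← eliminate (allFin n) {c} {λ e → alt c e (c (head e))}
           ((λ v∈e → proper _ _ (other-adj v∈e)) , λ {v} {e} v∈e → alt≢end {c = c} {x = c (head e)} v∈e)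
           (λ {x} _ → ∈-allFin x) =
    c′ , d , valid , λ {v} v∈e →
      decidable-stable (any? λ i → parity (count d (incident v) i) ℙ.≟ 1ℙ) λ ∄i →
        good ((_ , v∈e) , λ i → even (count d (incident v) i) (λ p → ∄i (i , p)))
    where
    even : ∀ k → parity k ≢ 1ℙ → parity k ≡ 0ℙ
    even k p with parity k
    ... | 0ℙ = refl
    ... | 1ℙ = contradiction refl p

-- Conflict-free colourings

-- Addition of 1 in ℤ/3, so `next ∘ next` subtracts 1.
next : Fin 3 → Fin 3
next 0F = 1F
next 1F = 2F
next 2F = 0F

next³ : ∀ x → next (next (next x)) ≡ x
next³ 0F = refl
next³ 1F = refl
next³ 2F = refl

next≢ : ∀ x → next x ≢ x
next≢ 0F ()
next≢ 1F ()
next≢ 2F ()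

next²≢ : ∀ x → next (next x) ≢ x
next²≢ 0F ()
next²≢ 1F ()
next²≢ 2F ()

≢⇒next : ∀ x y → x ≢ y → y ≡ next x ⊎ x ≡ next y
≢⇒next = toWitness {a? = all? λ x → all? λ y → ¬? (x ≟ y) →-dec ((y ≟ next x) ⊎-dec (x ≟ next y))} tt

inject₁≢3 : ∀ (x : Fin 3) → inject₁ x ≢ 3F
inject₁≢3 0F ()
inject₁≢3 1F ()
inject₁≢3 2F ()

sum-updateAt-suc : ∀ {n} (f : Fin n → ℕ) i →
  sum (tabulate (updateAt f i suc)) ≡ suc (sum (tabulate f))
sum-updateAt-suc f zero    = refl
sum-updateAt-suc f (suc i) =
  trans (cong (f zero +_) (sum-updateAt-suc (f ∘ suc) i)) (ℕ.+-suc (f zero) _)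

sum-≤ : ∀ {n} (f : Fin n → ℕ) {b} → (∀ i → f i ≤ b) → sum (tabulate f) ≤ n * b
sum-≤ {zero}  f f≤b = z≤n
sum-≤ {suc n} f f≤b = ℕ.+-mono-≤ (f≤b zero) (sum-≤ (f ∘ suc) (f≤b ∘ suc))

-- Greedy choice: an element is added unless some chosen one is related to it, and that one then
-- covers it.
maximal-independent : ∀ {A : Set} {_~_ : Rel A 0ℓ} → B.Decidable _~_ → B.Reflexive _~_ → B.Symmetric _~_ →
  ∀ xs → ∃ λ ys → (∀ {y z} → y ∈ ys → z ∈ ys → y ~ z → y ≡ z) × (∀ {x} → x ∈ xs → ∃ λ y → y ∈ ys × x ~ y)
maximal-independent _~?_ rfl symm [] = [] , (λ ()) , λ ()
maximal-independent {_~_ = _~_} _~?_ rfl symm (x ∷ xs)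
  with ys , indep , covers ← maximal-independent _~?_ rfl symm xs | Any.any? (x ~?_) ys
... | yes x~ys = ys , indep , λ { (here refl) → find x~ys ; (there z∈) → covers z∈ }
... | no ¬x~ys = x ∷ ys , indep′ ,
  λ { (here refl) → x , here refl , rfl ; (there z∈) → let y , y∈ , z~y = covers z∈ in y , there y∈ , z~y }
  where
  indep′ : ∀ {y z} → y ∈ x ∷ ys → z ∈ x ∷ ys → y ~ z → y ≡ z
  indep′ (here refl) (here refl) _   = refl
  indep′ (here refl) (there z∈)  y~z = contradiction (lose z∈ y~z) ¬x~ys
  indep′ (there y∈)  (here refl) y~z = contradiction (lose y∈ (symm y~z)) ¬x~ys
  indep′ (there y∈)  (there z∈)  y~z = indep y∈ z∈ y~z

-- Turning sources into sinks

module Rotation {n : ℕ} (G : Graph n) where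

  infix 4 _~_
  _~_ : Fin n → Fin n → Set
  _~_ = Adj G

  ~-sym : ∀ {u v} → u ~ v → v ~ u
  ~-sym = Graph.sym G

  Within : ℕ → Fin n → Fin n → Set
  Within zero    u v = u ≡ v
  Within (suc k) u v = u ≡ v ⊎ ∃ λ w → u ~ w × Within k w v

  within? : ∀ k u v → Dec (Within k u v)
  within? zero    u v = u ≟ v
  within? (suc k) u v = (u ≟ v) ⊎-dec any? λ w → adj? G u w ×-dec within? k w v

  within-refl : ∀ k {u} → Within k u u
  within-refl zero    = refl
  within-refl (suc k) = inj₁ refl

  within-snoc : ∀ k {u v w} → Within k u v → v ~ w → Within (suc k) u w
  within-snoc zero    refl             v~w = inj₂ (_ , v~w , refl)
  within-snoc (suc k) (inj₁ refl)      v~w = inj₂ (_ , v~w , inj₁ refl)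
  within-snoc (suc k) (inj₂ (x , p , q)) v~w = inj₂ (x , p , within-snoc k q v~w)

  within-sym : ∀ k {u v} → Within k u v → Within k v u
  within-sym zero    p                  = sym p
  within-sym (suc k) (inj₁ p)           = inj₁ (sym p)
  within-sym (suc k) (inj₂ (x , p , q)) = within-snoc k (within-sym k q) (~-sym p)

  -- An isolated vertex is vacuously a source.
  Source : (Fin n → Fin 3) → Fin n → Set
  Source c v = ∀ u → v ~ u → c u ≡ next (c v)

  source? : ∀ c → Decidable (Source c)
  source? c v = all? λ u → adj? G v u →-dec (c u ≟ next (c v))

  -- turns counts how often the colour of a vertex was decreased. Neighbours
  -- alternate in this, which bounds turns by the distance to R.
  record Rotated (R : List (Fin n)) : Set where
    field
      c      : Fin n → Fin 3
      turns  : Fin n → ℕ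
      proper : ∀ {u v} → u ~ v → c u ≢ c v
      fixed  : ∀ {r} → r ∈ R → turns r ≡ 0
      lag    : ∀ {u v} → u ~ v → c v ≡ next (c u) → turns u ≤ turns v × turns v ≤ suc (turns u)

    turns-step : ∀ {u v} → u ~ v → turns u ≤ suc (turns v)
    turns-step {u} {v} u~v with ≢⇒next (c u) (c v) (proper u~v)
    ... | inj₁ cv = ℕ.m≤n⇒m≤1+n (proj₁ (lag u~v cv))
    ... | inj₂ cu = proj₂ (lag (~-sym u~v) cu)

    turns-≤ : ∀ k {u r} → Within k u r → r ∈ R → turns u ≤ k
    turns-≤ zero    refl               r∈R = ℕ.≤-reflexive (fixed r∈R)
    turns-≤ (suc k) (inj₁ refl)        r∈R = ℕ.≤-trans (ℕ.≤-reflexive (fixed r∈R)) z≤n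
    turns-≤ (suc k) (inj₂ (x , p , q)) r∈R = ℕ.≤-trans (turns-step p) (s≤s (turns-≤ k q r∈R))

  open Rotated

  -- The neighbours of `u` have colour `c u + 1`, which is `(c u - 1) - 1` in ℤ/3. Subtracting 1 at
  -- `u` therefore keeps the colouring proper and reverses every edge at `u`.
  turn : ∀ {R} (σ : Rotated R) {u} → u ∉ R → Source (c σ) u → Rotated R
  turn {R} σ {u} u∉R src = record
    { c = c′ ; turns = t′ ; proper = proper′ ; fixed = fixed′ ; lag = lag′ }
    where
    c′ = updateAt (c σ) u (next ∘ next)
    t′ = updateAt (turns σ) u suc
    c′-at : c′ u ≡ next (next (c σ u))
    c′-at = updateAt-updates u (c σ)
    c′-off : ∀ {x} → x ≢ u → c′ x ≡ c σ x
    c′-off {x} = updateAt-minimal x u (c σ)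
    t′-at : t′ u ≡ suc (turns σ u)
    t′-at = updateAt-updates u (turns σ)
    t′-off : ∀ {x} → x ≢ u → t′ x ≡ turns σ x
    t′-off {x} = updateAt-minimal x u (turns σ)
    fixed′ : ∀ {r} → r ∈ R → t′ r ≡ 0
    fixed′ r∈R = trans (t′-off λ { refl → u∉R r∈R }) (fixed σ r∈R)
    c′-nbr : ∀ {x} → u ~ x → c′ x ≡ next (c σ u)
    c′-nbr u~x = trans (c′-off (λ p → Graph.irrefl G (sym p) u~x)) (src _ u~x)
    proper′ : ∀ {x y} → x ~ y → c′ x ≢ c′ y
    proper′ {x} {y} x~y p with x ≟ u | y ≟ u
    ... | yes refl | _        = next≢ _ (trans (sym c′-at) (trans p (c′-nbr x~y)))
    ... | no _     | yes refl = next≢ _ (trans (sym c′-at) (trans (sym p) (c′-nbr (~-sym x~y))))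
    ... | no x≢u   | no y≢u   = proper σ x~y (trans (sym (c′-off x≢u)) (trans p (c′-off y≢u)))
    lag′ : ∀ {x y} → x ~ y → c′ y ≡ next (c′ x) → t′ x ≤ t′ y × t′ y ≤ suc (t′ x)
    lag′ {x} {y} x~y p with x ≟ u | y ≟ u
    ... | yes refl | _ = contradiction
            (trans (sym (c′-nbr x~y)) (trans p (trans (cong next c′-at) (next³ _)))) (next≢ _)
    -- The edge now points into `u`: the bounds `turns u ≤ turns x ≤ turns u + 1` turn into those
    -- required once `turns u` has grown by 1.
    ... | no x≢u | yes refl rewrite t′-at | t′-off x≢u =
            let lo , hi = lag σ (~-sym x~y) (src _ (~-sym x~y)) in hi , s≤s lo
    ... | no x≢u | no y≢u rewrite t′-off x≢u | t′-off y≢u =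
            lag σ x~y (trans (sym (c′-off y≢u)) (trans p (cong next (c′-off x≢u))))

  -- k bounds the number of remaining steps, as each step increases the sum.
  rotate : ∀ {R b} → (∀ v → ∃ λ r → r ∈ R × Within b v r) →
    ∀ k (σ : Rotated R) → n * b ≤ k + sum (tabulate (turns σ)) →
    ∃ λ (τ : Rotated R) → ∀ {v} → Source (c τ) v → v ∈ R
  rotate {R} {b} near k σ bound with any? (λ u → ¬? (member? _≟_ u R) ×-dec source? (c σ) u)
  ... | no ∄u = σ , λ {v} src → decidable-stable (member? _≟_ v R) λ v∉R → ∄u (v , v∉R , src)
  rotate {R} {b} near zero σ bound | yes (u , u∉R , src) =
    -- Another turn would raise the sum above `n * b`, although each of the `n` vertices has at most
    -- `b` turns.
    contradiction (ℕ.≤-trans (sum-≤ _ λ v → let r , r∈R , p = near v in turns-≤ τ b p r∈R) bound)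
      (ℕ.<⇒≱ (ℕ.≤-reflexive (sym (sum-updateAt-suc (turns σ) u))))
    where τ = turn σ u∉R src
  rotate {R} {b} near (suc k) σ bound | yes (u , u∉R , src) =
    rotate near k (turn σ u∉R src)
      (ℕ.≤-trans bound (ℕ.≤-reflexive (trans (sym (ℕ.+-suc k _)) (cong (k +_) (sym (sum-updateAt-suc (turns σ) u))))))

  -- Maximality of `R` puts every vertex within distance `k` of it, which bounds the turning;
  -- independence keeps the surviving sources apart.
  separated-sources : ∀ k {c₀ : Fin n → Fin 3} → Proper G c₀ → ∃ λ c → Proper G c ×
    (∀ {u v} → Source c u → Source c v → Within k u v → u ≡ v)
  separated-sources k {c₀} proper₀
    with R , indep , covers ← maximal-independent (within? k) (within-refl k) (within-sym k) (allFin n)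
    with τ , src∈R ← rotate (λ v → covers (∈-allFin v)) (n * k)
           (record { c = c₀ ; turns = const 0 ; proper = proper₀ _ _ ; fixed = λ _ → refl ; lag = λ _ _ → z≤n , z≤n })
           (ℕ.m≤m+n _ _) =
    c τ , (λ _ _ → proper τ) , λ su sv → indep (src∈R su) (src∈R sv)

-- Colouring the edges along the orientation

module ConflictFreeColouring {n : ℕ} {G : Graph n} (E : EdgeList G) {c : Fin n → Fin 3} (proper : Proper G c)
  (separated : ∀ {u v} → Rotation.Source G c u → Rotation.Source G c v → Rotation.Within G 4 u v → u ≡ v)
  where

  open Incidence E
  open Rotation G hiding (Source; source?)

  Source : Fin n → Set
  Source = Rotation.Source G c

  opaque
    source? : Decidable Source
    source? = Rotation.source? G c

    -- For an isolated `r` the value `r` is a placeholder.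
    partner-of : ∀ r → ∃ λ w → ∀ {u} → r ~ u → r ~ w
    partner-of r with any? (adj? G r)
    ... | yes (w , r~w) = w , λ _ → r~w
    ... | no ∄w = r , λ r~u → contradiction (_ , r~u) ∄w

  partner : Fin n → Fin n
  partner r = proj₁ (partner-of r)

  Special : Fin n → Fin n → Set
  Special r w = Source r × r ~ w × w ≡ partner r

  special? : ∀ w → Dec (∃ λ r → Special r w)
  special? w = any? λ r → source? r ×-dec adj? G r w ×-dec (w ≟ partner r)

  infix 4 _↑_
  -- The edge is oriented from `u` into `v`.
  _↑_ : Fin n → Fin n → Set
  v ↑ u = v ~ u × c v ≡ next (c u)

  ↑⇒¬source : ∀ {v u} → v ↑ u → ¬ Source v
  ↑⇒¬source (v~u , p) src = next²≢ _ (sym (trans p (cong next (src _ v~u))))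

  -- A source r is chosen by all its out-neighbours and its partner by all its
  -- own; these choices do not collide because sources are far apart. Hence, of the
  -- edges at r or at its partner, only the one joining them gets colour 3.
  IsPred : Fin n → Fin n → Set
  IsPred v u = v ↑ u × (∀ {r} → Source r → v ~ r → u ≡ r) × (∀ {r w} → Special r w → v ↑ w → u ≡ w)

  -- A neighbouring source is preferred, then a special in-neighbour, then any in-neighbour.
  -- Separation leaves at most one candidate for each of the first two.
  pred-exists : ∀ v → ¬ Source v → ∃ (IsPred v)
  pred-exists v ¬src with any? (λ r → source? r ×-dec adj? G v r)
  ... | yes (r , src , v~r) =
    r , (v~r , src _ (~-sym v~r)) ,
    (λ src′ v~r′ → separated src src′ (inj₂ (_ , ~-sym v~r , inj₂ (_ , v~r′ , inj₁ refl)))) ,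
    -- The source of such a `w` is within distance 3 of `r`, hence equal to it; then `v` and `w`
    -- both have colour `c r + 1`, contrary to `v ↑ w`.
    λ (src′ , r′~w , _) (v~w , p) → contradiction
      (trans (sym p) (trans (src _ (~-sym v~r)) (sym (src-w src′ r′~w v~w)))) (next≢ _)
    where
    src-w : ∀ {r′ w} → Source r′ → r′ ~ w → v ~ w → c w ≡ next (c r)
    src-w src′ r′~w v~w
      with refl ← separated src′ src (inj₂ (_ , r′~w , inj₂ (_ , ~-sym v~w , inj₂ (_ , v~r , inj₁ refl)))) =
      src′ _ r′~w
  ... | no ∄r with any? (λ w → special? w ×-dec adj? G v w ×-dec (c v ≟ next (c w)))
  ...   | yes (w , (r , src , r~w , w≡) , v~w , p) =
    w , (v~w , p) , (λ src′ v~r′ → contradiction (_ , src′ , v~r′) ∄r) ,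
    -- Sources of two special in-neighbours are within distance 4, so they coincide and so do their
    -- partners.
    λ (src′ , r′~w′ , w′≡) (v~w′ , _) → trans w≡ (trans (cong partner
      (separated src src′ (inj₂ (_ , r~w , inj₂ (_ , ~-sym v~w , inj₂ (_ , v~w′ , inj₂ (_ , ~-sym r′~w′ , refl))))))) (sym w′≡))
  ...   | no ∄w with any? (λ u → adj? G v u ×-dec (c v ≟ next (c u)))
  ...     | yes (u , up) = u , up , (λ src v~r → contradiction (_ , src , v~r) ∄r) ,
    λ sp up′ → contradiction (_ , (_ , sp) , up′) ∄w
  ...     | no ∄u = contradiction src ¬src
    where
    src : Source v
    src u v~u with ≢⇒next (c v) (c u) (proper _ _ v~u)
    ... | inj₁ p = p
    ... | inj₂ p = contradiction (u , v~u , p) ∄u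

  opaque
    pred-of : ∀ v → ∃ λ u → ¬ Source v → IsPred v u
    pred-of v with source? v
    ... | yes src = v , contradiction src
    ... | no ¬src = let u , p = pred-exists v ¬src in u , λ _ → p

  pred : Fin n → Fin n
  pred v = proj₁ (pred-of v)

  isPred : ∀ {v} → ¬ Source v → IsPred v (pred v)
  isPred {v} = proj₂ (pred-of v)

  -- Every edge into `v` has ends coloured `c v - 1` and `c v`, so `c v + 1` is the colour missing
  -- on all of them.
  third : Fin n → Fin 4
  third v = inject₁ (next (c v))

  -- For an edge oriented from `u` into `v`. At a special `v` the colours `3F` and `third v`
  -- exchange roles, with the source in the place of `pred v`.
  IsArcColour : Fin n → Fin n → Fin 4 → Set
  IsArcColour u v t =
    (t ≡ 3F ⊎ t ≡ third v) ×
    (∀ {r} → Special r v → (u ≡ r → t ≡ 3F) × (u ≢ r → t ≡ third v)) ×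
    (¬ (∃ λ r → Special r v) → (u ≡ pred v → t ≡ third v) × (u ≢ pred v → t ≡ 3F))

  special-unique : ∀ {r r′ w} → Special r w → Special r′ w → r ≡ r′
  special-unique (src , r~w , _) (src′ , r′~w , _) =
    separated src src′ (inj₂ (_ , r~w , inj₂ (_ , ~-sym r′~w , inj₁ refl)))

  opaque
    arc-of : ∀ u v → ∃ (IsArcColour u v)
    arc-of u v with special? v
    ... | yes (r , sp) with u ≟ r
    ...   | yes u≡r = 3F , inj₁ refl ,
      (λ sp′ → (λ _ → refl) , λ u≢r′ → contradiction (trans u≡r (special-unique sp sp′)) u≢r′) ,
      contradiction (r , sp)
    ...   | no u≢r = third v , inj₂ refl ,
      (λ sp′ → (λ u≡r′ → contradiction (trans u≡r′ (special-unique sp′ sp)) u≢r) , λ _ → refl) ,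
      contradiction (r , sp)
    arc-of u v | no ¬sp with u ≟ pred v
    ... | yes p = third v , inj₂ refl , (λ sp → contradiction (_ , sp) ¬sp) ,
      λ _ → (λ _ → refl) , contradiction p
    ... | no ¬p = 3F , inj₁ refl , (λ sp → contradiction (_ , sp) ¬sp) ,
      λ _ → (λ p → contradiction p ¬p) , λ _ → refl

  arc : Fin n → Fin n → Fin 4
  arc u v = proj₁ (arc-of u v)

  arc-range : ∀ u v → arc u v ≡ 3F ⊎ arc u v ≡ third v
  arc-range u v = proj₁ (proj₂ (arc-of u v))

  arc-special : ∀ {u v r} → Special r v → (u ≡ r → arc u v ≡ 3F) × (u ≢ r → arc u v ≡ third v)
  arc-special {u} {v} = proj₁ (proj₂ (proj₂ (arc-of u v)))

  arc-normal : ∀ {u v} → ¬ (∃ λ r → Special r v) → (u ≡ pred v → arc u v ≡ third v) × (u ≢ pred v → arc u v ≡ 3F)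
  arc-normal {u} {v} = proj₂ (proj₂ (proj₂ (arc-of u v)))

  opaque
    -- The order of `tail` and `head` is unrelated to the orientation; the condition on `v` selects
    -- the end into which the edge points.
    edge-colour-of : ∀ e → ∃ λ t → ∀ {v} → IsEnd v e → c v ≡ next (c (other v e)) → t ≡ arc (other v e) v
    edge-colour-of e with c (head e) ≟ next (c (tail e))
    ... | yes p = arc (tail e) (head e) , λ where
      (inj₁ refl) q → contradiction (trans q (cong next (trans (cong c (other-tail e)) p))) (next²≢ _ ∘ sym)
      (inj₂ refl) q → cong (λ u → arc u (head e)) (sym (other-head e))
    ... | no ¬p = arc (head e) (tail e) , λ where
      (inj₁ refl) q → cong (λ u → arc u (tail e)) (sym (other-tail e))
      (inj₂ refl) q → contradiction (trans q (cong (next ∘ c) (other-head e))) ¬p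

  d : Fin m → Fin 4
  d e = proj₁ (edge-colour-of e)

  d-up : ∀ {v e} → IsEnd v e → c v ≡ next (c (other v e)) → d e ≡ arc (other v e) v
  d-up {e = e} = proj₂ (edge-colour-of e)

  d-down : ∀ {v e} → IsEnd v e → c (other v e) ≡ next (c v) → d e ≡ arc v (other v e)
  d-down {v} {e} v∈e p = trans
    (d-up (other-end v∈e) (trans p (cong (next ∘ c) (sym (other-other v∈e)))))
    (cong (λ u → arc u (other v e)) (other-other v∈e))

  direction : ∀ {v e} → IsEnd v e → c (other v e) ≡ next (c v) ⊎ c v ≡ next (c (other v e))
  direction v∈e = ≢⇒next _ _ (proper _ _ (other-adj v∈e))

  third≢3 : ∀ {v} → third v ≢ 3F
  third≢3 = inject₁≢3 _

  valid : Valid (inject₁ ∘ c) d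
  valid = (λ v∈e p → proper _ _ (other-adj v∈e) (inject₁-injective p)) , go
    where
    go : ∀ {v e} → IsEnd v e → inject₁ (c v) ≢ d e
    go {v} {e} v∈e p with direction v∈e
    ... | inj₂ q with arc-range (other v e) v
    ...   | inj₁ r = inject₁≢3 _ (trans p (trans (d-up v∈e q) r))
    ...   | inj₂ r = next≢ _ (sym (inject₁-injective (trans p (trans (d-up v∈e q) r))))
    go {v} {e} v∈e p | inj₁ q with arc-range v (other v e)
    ...   | inj₁ r = inject₁≢3 _ (trans p (trans (d-down v∈e q) r))
    ...   | inj₂ r = next²≢ _ (sym (trans (inject₁-injective (trans p (trans (d-down v∈e q) r))) (cong next q)))

  unique-colour : ∀ {u v i} → v ~ u → (∀ {e} → IsEnd v e → u ≡ other v e → d e ≡ i) →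
    (∀ {e} → IsEnd v e → d e ≡ i → other v e ≡ u) → count d (incident v) i ≡ 1
  unique-colour {u} {v} {i} v~u at only
    with e , v∈e , u∈e ← edge-between v~u with end-cases v∈e u∈e
  ... | inj₁ u≡v = contradiction v~u (Graph.irrefl G (sym u≡v))
  ... | inj₂ u≡ = count-unique (incident-unique v) (∈-incident v∈e) (at v∈e u≡) λ e′∈ p →
    let v∈e′ = incident-∈ e′∈ in
    ends-unique (λ v≡u → Graph.irrefl G v≡u v~u) v∈e′ (subst (λ x → IsEnd x _) (only v∈e′ p) (other-end v∈e′)) v∈e u∈e

  -- All edges leave `v`. An out-neighbour `x` other than the partner has `pred x ≡ v`, and it is
  -- not special, as its source would be within distance 2 of `v`. So its edge gets `third x`.
  unique-at-source : ∀ {v u} → Source v → v ~ u → count d (incident v) 3F ≡ 1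
  unique-at-source {v} src v~u = unique-colour v~w
    (λ v∈e w≡ → trans (d-down v∈e (trans (cong c (sym w≡)) (src _ v~w)))
      (trans (cong (arc v) (sym w≡)) (proj₁ (arc-special sp) refl)))
    λ {e} v∈e p → decidable-stable (other v e ≟ partner v) λ x≢w →
      let x = other v e
          v~x = other-adj v∈e
          x↑v = ~-sym v~x , src _ v~x
          x-normal = λ (r , src′ , r~x , x≡) → x≢w (trans x≡ (cong partner
            (separated src′ src (inj₂ (_ , r~x , inj₂ (_ , ~-sym v~x , inj₁ refl))))))
          v≡pred = sym (proj₁ (proj₂ (isPred (↑⇒¬source x↑v))) src (~-sym v~x))
      in third≢3 (trans (sym (proj₁ (arc-normal x-normal) v≡pred)) (trans (sym (d-down v∈e (src _ v~x))) p))
    where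
    v~w : v ~ partner v
    v~w = proj₂ (partner-of v) v~u
    sp : Special v (partner v)
    sp = src , v~w , refl

  -- The exchange of roles leaves `3F` only on `r` among the edges into `w`. An edge leaving `w`
  -- ends in a vertex with predecessor `w`, which is not special since its source would be `r`; so
  -- that edge avoids `3F`.
  unique-at-special : ∀ {r w} → Special r w → count d (incident w) 3F ≡ 1
  unique-at-special {r} {w} sp@(src , r~w , w≡) = unique-colour (~-sym r~w)
    (λ w∈e r≡ → trans (d-up w∈e (trans (src _ r~w) (cong (next ∘ c) r≡))) (proj₁ (arc-special sp) (sym r≡)))
    only
    where
    only : ∀ {e} → IsEnd w e → d e ≡ 3F → other w e ≡ r
    only {e} w∈e p with direction w∈e
    ... | inj₂ q = decidable-stable (other w e ≟ r) λ x≢r →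
      third≢3 (trans (sym (proj₂ (arc-special sp) x≢r)) (trans (sym (d-up w∈e q)) p))
    ... | inj₁ q = contradiction (trans (sym (proj₁ (arc-normal x-normal) w≡pred)) (trans (sym (d-down w∈e q)) p)) third≢3
      where
      w~x = other-adj w∈e
      x↑w = ~-sym w~x , q
      w≡pred = sym (proj₂ (proj₂ (isPred (↑⇒¬source x↑w))) sp x↑w)
      x-normal : ¬ ∃ λ r′ → Special r′ (other w e)
      x-normal (r′ , src′ , r′~x , x≡) = other≢ w∈e (trans x≡ (trans (cong partner
        (separated src′ src (inj₂ (_ , r′~x , inj₂ (_ , ~-sym w~x , inj₂ (_ , ~-sym r~w , inj₁ refl)))))) (sym w≡)))

  unique-at-normal : ∀ {v} → ¬ Source v → ¬ (∃ λ r → Special r v) → count d (incident v) (third v) ≡ 1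
  unique-at-normal {v} ¬src ¬sp = unique-colour (proj₁ up)
    (λ v∈e u≡ → trans (d-up v∈e (trans (proj₂ up) (cong (next ∘ c) u≡))) (proj₁ (arc-normal ¬sp) (sym u≡)))
    only
    where
    up = proj₁ (isPred ¬src)
    only : ∀ {e} → IsEnd v e → d e ≡ third v → other v e ≡ pred v
    only {e} v∈e p with direction v∈e
    ... | inj₂ q = decidable-stable (other v e ≟ pred v) λ x≢ →
      third≢3 (trans (sym p) (trans (d-up v∈e q) (proj₂ (arc-normal ¬sp) x≢)))
    ... | inj₁ q with arc-range v (other v e)
    ...   | inj₁ r = contradiction (trans (sym p) (trans (d-down v∈e q) r)) third≢3
    -- The edge towards `x` carries `c x + 1`, whereas `third v` is `c v + 1`, that is, `c x`.
    ...   | inj₂ r = contradiction (inject₁-injective (trans (sym r) (trans (sym (d-down v∈e q)) (trans p (cong inject₁ (sym q)))))) (next≢ _)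

  conflict-free : ∀ {v e} → IsEnd v e → ∃ λ i → count d (incident v) i ≡ 1
  conflict-free {v} v∈e with source? v
  ... | yes src = 3F , unique-at-source src (other-adj v∈e)
  ... | no ¬src with special? v
  ...   | yes (r , sp) = 3F , unique-at-special sp
  ...   | no ¬sp = third v , unique-at-normal ¬src ¬sp

-- The four-cycle

side : Fin 4 → Bool
side 0F = false
side 1F = false
side 2F = true
side 3F = true

-- The cycle 0 2 1 3, as the complete bipartite graph with sides 0, 1 and 2, 3.
four-cycle : Graph 4
four-cycle = record
  { Adj    = λ u v → side u ≢ side v
  ; adj?   = λ u v → ¬? (side u Bool.≟ side v)
  ; sym    = λ p → p ∘ sym
  ; irrefl = λ { refl p → p refl }
  }

-- The 8-cycle S four-cycle is traversed as 0 4 2 6 1 7 3 5.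
eight-cycle-colouring : Coloring 8 4
eight-cycle-colouring 0F = 0F
eight-cycle-colouring 4F = 1F
eight-cycle-colouring 2F = 2F
eight-cycle-colouring 6F = 3F
eight-cycle-colouring 1F = 0F
eight-cycle-colouring 7F = 1F
eight-cycle-colouring 3F = 2F
eight-cycle-colouring 5F = 3F

eight-cycle-odd : ProperOdd (S four-cycle) eight-cycle-colouring
eight-cycle-odd = toWitness
  {a? = properWith? (S four-cycle) (λ k → parity k ℙ.≟ 1ℙ) eight-cycle-colouring} tt

-- Two neighbours of one colour yield only the counts 0 and 2.
odd-pair : ∀ {A : Set} {k} (c : A → Fin k) {x y} →
  (∃ λ i → parity (count c (x ∷ y ∷ []) i) ≡ 1ℙ) → c x ≢ c y
odd-pair c {x} {y} (i , odd) p = go (c x ≟ i)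
  where
  go : Dec (c x ≡ i) → ⊥
  go (yes q) = parity-0≢1 (count c (x ∷ y ∷ []) i)
    (cong (parity ∘ length) (filter-all (λ w → c w ≟ i) (q ∷ trans (sym p) q ∷ []))) odd
  go (no ¬q) = parity-0≢1 (count c (x ∷ y ∷ []) i)
    (cong (parity ∘ length) (filter-none (λ w → c w ≟ i) (¬q ∷ ¬q ∘ trans p ∷ []))) odd

three-colours-repeat : ∀ (x y z w : Fin 3) → x ≢ y → x ≢ z → y ≢ z → y ≢ w → z ≢ w → x ≡ w
three-colours-repeat = toWitness
  {a? = all? λ x → all? λ y → all? λ z → all? λ w → ¬? (x ≟ y) →-dec ¬? (x ≟ z) →-dec
        ¬? (y ≟ z) →-dec ¬? (y ≟ w) →-dec ¬? (z ≟ w) →-dec (x ≟ w)} tt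

eight-cycle-not-three : ∀ {c : Coloring 8 3} → ¬ ProperOdd (S four-cycle) c
eight-cycle-not-three {c} (proper , odd) =
  proper 0F 4F (inj₁ refl)
    -- Three jumps of length 3, from 0 to 6 to 3 to 4, go once round the cycle and one step further,
    -- so the adjacent 0 and 4 agree.
    (trans (three-colours-repeat _ _ _ _ d04 d02 d42 d46 d26)
    (trans (three-colours-repeat _ _ _ _ d61 d67 d17 d13 d73)
           (three-colours-repeat _ _ _ _ d35 d30 d50 d54 d04)))
  where
  d04 : c 0F ≢ c 4F
  d04 = proper 0F 4F (inj₁ refl)
  d42 : c 4F ≢ c 2F
  d42 = proper 4F 2F (inj₂ refl)
  d26 : c 2F ≢ c 6F
  d26 = proper 2F 6F (inj₂ refl)
  d61 : c 6F ≢ c 1F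
  d61 = proper 6F 1F (inj₁ refl)
  d17 : c 1F ≢ c 7F
  d17 = proper 1F 7F (inj₁ refl)
  d73 : c 7F ≢ c 3F
  d73 = proper 7F 3F (inj₂ refl)
  d35 : c 3F ≢ c 5F
  d35 = proper 3F 5F (inj₂ refl)
  d50 : c 5F ≢ c 0F
  d50 = proper 5F 0F (inj₁ refl)
  d02 : c 0F ≢ c 2F
  d02 = odd-pair c (odd 4F (0F , inj₁ refl))
  d46 : c 4F ≢ c 6F
  d46 = odd-pair c (odd 2F (4F , inj₂ refl))
  d67 : c 6F ≢ c 7F
  d67 = odd-pair c (odd 1F (6F , inj₁ refl))
  d13 : c 1F ≢ c 3F
  d13 = odd-pair c (odd 7F (1F , inj₁ refl)) 
  d30 : c 3F ≢ c 0F
  d30 = odd-pair c (odd 5F (0F , inj₁ refl)) ∘ sym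
  d54 : c 5F ≢ c 4F
  d54 = odd-pair c (odd 0F (4F , inj₁ refl)) ∘ sym

-- Spare colours and the three claims

proper-inject : ∀ {n j k} {G : Graph n} (j≤k : j ≤ k) {c : Coloring n j} →
  Proper G c → Proper G (λ v → inject≤ (c v) j≤k)
proper-inject j≤k proper u v u~v p = proper u v u~v (inject≤-injective j≤k j≤k _ _ p)

-- The injection preserves counts. It lets the exclusion of three colours cover every smaller number
-- as well.
proper-odd-inject : ∀ {n j k} (G : Graph n) {c : Coloring n j} (j≤k : j ≤ k) →
  ProperOdd G c → ProperOdd G (λ v → inject≤ (c v) j≤k)
proper-odd-inject G {c} j≤k (proper , odd) =
  proper-inject {G = G} j≤k proper ,
  λ v ni → let i , p = odd v ni in inject≤ i j≤k ,
    trans (cong parity (count-cong (neighbours G v) λ _ →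
      inject≤-injective j≤k j≤k _ _ , cong (λ x → inject≤ x j≤k))) p

χₒ-eight-cycle : χₒ (S four-cycle) 4
χₒ-eight-cycle = (eight-cycle-colouring , eight-cycle-odd) , λ j (c , odd) →
  ℕ.≰⇒> λ j≤3 → eight-cycle-not-three (proper-odd-inject (S four-cycle) j≤3 odd)

χpcf-subdivision : ∀ {n} (G : Graph n) → χ G ≤ᵛ 3 → χpcf (S G) ≤ᵛ 4
χpcf-subdivision G (_ , ((_ , proper) , _) , k≤3)
  -- The distance 4 comes from the path source, partner, common neighbour, partner, source in
  -- `pred-exists`.
  with _ , proper′ , separated ← Rotation.separated-sources G 4 (proper-inject {G = G} k≤3 proper) =
  properWith-≤ᵛ (S G) (ℕ._≟ 1) (_ , colouring-properWith (_≡ 1) refl valid conflict-free)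
  where
  open SubdivisionColouring G
  open ConflictFreeColouring (edgeList G) proper′ separated

χₒ-subdivision : ∀ {n} (G : Graph n) → χ G ≤ᵛ 4 → χₒ (S G) ≤ᵛ 4
χₒ-subdivision G (_ , ((_ , proper) , _) , k≤4)
  with _ , _ , valid , odd ← OddColouring.odd-colouring (edgeList G) _ (proper-inject {G = G} k≤4 proper) =
  properWith-≤ᵛ (S G) (λ k → parity k ℙ.≟ 1ℙ)
    (_ , SubdivisionColouring.colouring-properWith G (λ k → parity k ≡ 1ℙ) refl valid odd)

proposition1p8 : (∀ (n : ℕ) (G : Graph n) → χ G ≤ᵛ 3 → χpcf (S G) ≤ᵛ 4)
    × (∀ (n : ℕ) (G : Graph n) → χ G ≤ᵛ 4 → χₒ (S G) ≤ᵛ 4)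
    × (∃ λ (n : ℕ) → ∃ λ (G : Graph n) → Bipartite G × χₒ (S G) 4)
proposition1p8 =
  (λ _ → χpcf-subdivision) ,
  (λ _ → χₒ-subdivision) ,
  4 , four-cycle , (side , λ _ _ → id) , χₒ-eight-cycle
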